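{- Let $\mathbf{x}=(x_1,x_2,x_3)$ be a vector of positive integers and let $\mathbf{q}=(\mathbf{r},\mathbf{x})$, where $\mathbf{r}$ is one of the following: (i) $\mathbf{r}=(1,\,1+x_1,\,(1+x_1)(1+x_2))$; (ii) $\mathbf{r}=(1+x_2,\,1+x_1(1+x_2),\,(1+x_1(1+x_2))(1+x_2))$; (iv) $\mathbf{r}=(1,\,(1+x_1)(1+x_3),\,(1+x_1)(1+x_2(1+x_3)))$. Then $\Delta_{(1,\mathbf{q})}$ is $h^*$-unimodal.
   Context: For $\mathbf{r}=(r_1,r_2,r_3)$ with $r_1<r_2<r_3$ and positive integers $x_1,x_2,x_3$, $(\mathbf{r},\mathbf{x})$ denotes the vector consisting of $x_1$ copies of $r_1$, $x_2$ copies of $r_2$, $x_3$ copies of $r_3$. For $\mathbf{q}=(q_1,\ldots,q_n)\in\mathbb{Z}_{\geq1}^n$, $\Delta_{(1,\mathbf{q})}:=\mathrm{conv}\{\mathbf{e}_1,\ldots,\mathbf{e}_n,-\sum_i q_i\mathbf{e}_i\}\subset\mathbb{R}^n$. For a lattice polytope $P$, the Ehrhart series is $\sum_{t\geq0}|tP\cap\mathbb{Z}^n|z^t=h^*(P;z)/(1-z)^{\dim P+1}$ where $h^*(P;z)=h_0^*+h_1^*z+\cdots+h_d^*z^d$ is the $h^*$-polynomial. $P$ is $h^*$-unimodal if there is $t$ with $h_0^*\leq\cdots\leq h_t^*\geq\cdots\geq h_d^*$. -}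

module Defs where

open import Data.Nat as ℕ using (ℕ; zero; suc)
open import Data.Nat.Combinatorics using (_C_)
open import Data.Integer as ℤ using (ℤ; +_)
open import Data.Rational as ℚ using (ℚ)
open import Data.Fin using (Fin; zero; suc)
open import Data.Vec using (Vec; replicate; _++_; lookup)
open import Data.List using (List; length)
open import Data.List.Membership.Propositional using (_∈_)
open import Data.List.Relation.Unary.Unique.Propositional using (Unique)
open import Data.Product using (Σ; _×_)
open import Relation.Binary.PropositionalEquality using (_≡_)
open import Function.Bundles using (_⇔_)

ℤ→ℚ : ℤ → ℚ
ℤ→ℚ z = z ℚ./ 1

ℕ→ℚ : ℕ → ℚ
ℕ→ℚ n = ℤ→ℚ (+ n)

sumℚ : (n : ℕ) → (Fin n → ℚ) → ℚ
sumℚ zero    f = ℚ.0ℚ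
sumℚ (suc n) f = f zero ℚ.+ sumℚ n (λ i → f (suc i))

repVec : (r₁ r₂ r₃ x₁ x₂ x₃ : ℕ) → Vec ℕ (x₁ ℕ.+ (x₂ ℕ.+ x₃))
repVec r₁ r₂ r₃ x₁ x₂ x₃ = replicate x₁ r₁ ++ (replicate x₂ r₂ ++ replicate x₃ r₃)

-- Membership of a point p ∈ ℤⁿ in the t-th dilate t·Δ_(1,q), where
-- Δ_(1,q) = conv{e₁,…,eₙ, -Σ qᵢ eᵢ}.  t·conv{v₀,…,vₙ} = {Σ μⱼ vⱼ : μ ≥ 0, Σ μ = t}.
-- μ zero is the coefficient of v₀ = -q, μ (suc i) that of e_i.
InDilate : (n : ℕ) → Vec ℕ n → ℕ → Vec ℤ n → Set
InDilate n q t p =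
  Σ (Fin (suc n) → ℚ) λ μ →
    ((j : Fin (suc n)) → ℚ.0ℚ ℚ.≤ μ j) ×
    (sumℚ (suc n) μ ≡ ℕ→ℚ t) ×
    ((i : Fin n) → ℤ→ℚ (lookup p i) ≡ μ (suc i) ℚ.- μ zero ℚ.* ℕ→ℚ (lookup q i))

IsLatticeCount : (n : ℕ) → Vec ℕ n → ℕ → ℕ → Set
IsLatticeCount n q t N =
  Σ (List (Vec ℤ n)) λ ps →
    Unique ps × (length ps ≡ N) × ((p : Vec ℤ n) → (p ∈ ps) ⇔ InDilate n q t p)

sumUpTo : ℕ → (ℕ → ℤ) → ℤ
sumUpTo zero    f = f 0
sumUpTo (suc k) f = sumUpTo k f ℤ.+ f (suc k)

sign : ℕ → ℤ
sign zero    = + 1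
sign (suc j) = ℤ.- sign j

-- coefficient of z^k in (1-z)^(d+1) · Σ_t L(t) z^t, i.e. h*_k for a d-dimensional polytope
hstar : (d : ℕ) → (ℕ → ℕ) → ℕ → ℤ
hstar d L k = sumUpTo k (λ j → sign j ℤ.* (+ ((suc d) C j) ℤ.* + (L (k ℕ.∸ j))))

Unimodal : (d : ℕ) → (ℕ → ℤ) → Set
Unimodal d h =
  Σ ℕ λ t → (t ℕ.≤ d) ×
    (((i : ℕ) → i ℕ.< t → h i ℤ.≤ h (suc i)) ×
     ((i : ℕ) → t ℕ.≤ i → suc i ℕ.≤ d → h (suc i) ℤ.≤ h i))

-- Δ_(1,q) (full-dimensional, dim = n) is h*-unimodal
HStarUnimodal : (n : ℕ) → Vec ℕ n → Set
HStarUnimodal n q = (L : ℕ → ℕ) → ((t : ℕ) → IsLatticeCount n q t (L t)) → Unimodal n (hstar n L)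

data RCase (x₁ x₂ x₃ : ℕ) : ℕ → ℕ → ℕ → Set where
  case-i  : RCase x₁ x₂ x₃ 1 (1 ℕ.+ x₁) ((1 ℕ.+ x₁) ℕ.* (1 ℕ.+ x₂))
  case-ii : RCase x₁ x₂ x₃ (1 ℕ.+ x₂) (1 ℕ.+ x₁ ℕ.* (1 ℕ.+ x₂))
                             ((1 ℕ.+ x₁ ℕ.* (1 ℕ.+ x₂)) ℕ.* (1 ℕ.+ x₂))
  case-iv : RCase x₁ x₂ x₃ 1 ((1 ℕ.+ x₁) ℕ.* (1 ℕ.+ x₃))
                             ((1 ℕ.+ x₁) ℕ.* (1 ℕ.+ x₂ ℕ.* (1 ℕ.+ x₃)))

{-# OPTIONS --safe #-}
module Submission where

-- Write Q = 1 + Σ qᵢ and w(b) = b − Σᵢ ⌊b qᵢ / Q⌋. A point p of t·Δ_(1,q) is determined by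
-- m = t − Σ pᵢ, which is Q times its barycentric coordinate at −q, and the slacks
-- aᵢ = pᵢ + ⌊m qᵢ / Q⌋ ≥ 0. With m = b + k Q, b < Q, the points of t·Δ_(1,q) thus correspond to the
-- tuples (b , k , a) with w(b) + k + Σ aᵢ = t, so that h*(z) = Σ_{b<Q} z^w(b).
--
-- Put [m] = 1 + z + ⋯ + z^(m−1). Writing b in a suitable mixed radix turns w(b) into a sum of
-- digits, which gives h* equal to
--   (i)   [x₁+1][x₂+1][x₃+1],
--   (ii)  [x₃+1] ([x₁+1][x₂+1] + (1+x₂) z [x₁][x₂]),
--   (iv)  [x₁+1] ([x₂+1][x₃+1] + (1+x₃) z [x₂][x₃]).
-- Multiplication by [m] preserves symmetric unimodality, and the two summands in (ii) and (iv)
-- have the same centre of symmetry.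

open import Defs
open import Data.Fin using (Fin; zero; suc)
import Data.Integer as ℤ renaming (+_ to int)
open ℤ using (ℤ; int; -[1+_])
import Data.Integer.Properties as ℤ
open import Algebra.Properties.AbelianGroup ℤ.+-0-abelianGroup using (∙-cancelˡ; ∙-cancelʳ)
open import Data.Integer.Tactic.RingSolver using () renaming (solve-∀ to solve-∀ℤ)
open import Data.List as List using (List; []; _∷_; length)
open import Data.List.Membership.Propositional using (_∈_)
open import Data.List.Membership.Propositional.Properties using (∈-map⁺; ∈-map⁻; ∈-++⁺ˡ; ∈-++⁺ʳ; ∈-++⁻)
open import Data.List.Membership.Propositional.Properties.WithK using (unique∧set⇒bag)
open import Data.List.Properties using (length-map; length-++)
open import Data.List.Relation.Binary.BagAndSetEquality using (∼bag⇒↭)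
open import Data.List.Relation.Binary.Permutation.Propositional.Properties using (↭-length)
open import Data.List.Relation.Unary.All as All using ([]; _∷_)
import Data.List.Relation.Unary.All.Properties as All
open import Data.List.Relation.Unary.AllPairs using ([]; _∷_)
open import Data.List.Relation.Unary.Any using (here; there)
open import Data.List.Relation.Unary.Unique.Propositional using (Unique)
import Data.List.Relation.Unary.Unique.Propositional.Properties as Unique
open import Data.Nat as ℕ
open import Data.Nat.Combinatorics using (_C_; nCk≡nC[n∸k]; nCn≡1; nCk+nC[k+1]≡[n+1]C[k+1])
open import Data.Nat.Divisibility using (divides-refl)
open import Data.Nat.DivMod
open import Data.Nat.Properties
open import Data.Nat.Tactic.RingSolver using (solve-∀)
open import Data.Product using (Σ; ∃; _×_; _,_; proj₁)
import Data.Rational as ℚ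
open ℚ using (ℚ; 0ℚ; 1ℚ)
import Data.Rational.Properties as ℚ
open import Data.Rational.Solver using (module +-*-Solver)
import Data.Rational.Unnormalised as ℚᵘ
import Data.Rational.Unnormalised.Properties as ℚᵘ
open import Data.Sum as Sum using (_⊎_; inj₁; inj₂)
open import Data.Vec as Vec using (Vec; []; _∷_; lookup; replicate)
open import Data.Vec.Properties using (∷-injectiveˡ; ∷-injectiveʳ; sum-++)
open import Function using (_∘_; id; _⇔_; mk⇔; Equivalence)
open import Relation.Binary.PropositionalEquality
open import Relation.Nullary using (¬_; yes; no; contradiction)

-- The digits exist because every rᵢ of the three families divides Q: with D = Q / rᵢ the floor ⌊b
-- rᵢ / Q⌋ is the plain quotient of b by D. In (i) the three values D form a chain of divisors, so
-- one mixed-radix expansion of b shows all floors. In (ii) and (iv) two of the values D are, up to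
-- a common factor, S and B = 1 + x S, which are coprime, and no single expansion serves both. The
-- congruence B ≡ 1 mod S settles this: v + u B has quotient u by B, while modulo S it agrees with u
-- + v. The weight then contains the last base-S digit of u + v plus the quotient of u + v by S,
-- whose distribution `digitSum-sum` computes.

-- Finite sums over initial segments of ℕ

Σ< : ℕ → (ℕ → ℕ) → ℕ
Σ< zero    f = 0
Σ< (suc n) f = Σ< n f + f n

Σ<-cong : ∀ n {f g : ℕ → ℕ} → (∀ i → i < n → f i ≡ g i) → Σ< n f ≡ Σ< n g
Σ<-cong zero    f≗g = refl
Σ<-cong (suc n) f≗g = cong₂ _+_ (Σ<-cong n λ i i<n → f≗g i (m<n⇒m<1+n i<n)) (f≗g n ≤-refl)

Σ<-zero : ∀ n → Σ< n (λ _ → 0) ≡ 0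
Σ<-zero zero    = refl
Σ<-zero (suc n) = trans (+-identityʳ _) (Σ<-zero n)

Σ<-distrib-+ : ∀ n f g → Σ< n (λ i → f i + g i) ≡ Σ< n f + Σ< n g
Σ<-distrib-+ zero    f g = refl
Σ<-distrib-+ (suc n) f g =
  trans (cong (_+ (f n + g n)) (Σ<-distrib-+ n f g)) (interchange (Σ< n f) (Σ< n g) (f n) (g n))
  where
  interchange : ∀ a b c d → (a + b) + (c + d) ≡ (a + c) + (b + d)
  interchange = solve-∀

Σ<-const : ∀ n c → Σ< n (λ _ → c) ≡ n * c
Σ<-const zero    c = refl
Σ<-const (suc n) c = trans (+-comm _ c) (cong (c ℕ.+_) (Σ<-const n c))

Σ<-*ˡ : ∀ n c f → Σ< n (λ i → c * f i) ≡ c * Σ< n f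
Σ<-*ˡ zero    c f = sym (*-zeroʳ c)
Σ<-*ˡ (suc n) c f = trans (cong (_+ c * f n) (Σ<-*ˡ n c f)) (sym (*-distribˡ-+ c (Σ< n f) (f n)))

Σ<-swap : ∀ m n (f : ℕ → ℕ → ℕ) → Σ< m (λ i → Σ< n (f i)) ≡ Σ< n (λ j → Σ< m (λ i → f i j))
Σ<-swap zero    n f = sym (Σ<-zero n)
Σ<-swap (suc m) n f = trans (cong (_+ Σ< n (f m)) (Σ<-swap m n f)) (sym (Σ<-distrib-+ n _ (f m)))

Σ<-front : ∀ n f → Σ< (suc n) f ≡ f 0 + Σ< n (f ∘ suc)
Σ<-front zero    f = +-comm 0 (f 0)
Σ<-front (suc n) f = trans (cong (_+ f (suc n)) (Σ<-front n f)) (+-assoc (f 0) _ _)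

Σ<-split : ∀ m n f → Σ< (m + n) f ≡ Σ< m f + Σ< n (λ i → f (m + i))
Σ<-split m zero    f = trans (cong (λ k → Σ< k f) (+-identityʳ m)) (sym (+-identityʳ _))
Σ<-split m (suc n) f = begin
  Σ< (m + suc n) f                                 ≡⟨ cong (λ k → Σ< k f) (+-suc m n) ⟩
  Σ< (m + n) f + f (m + n)                         ≡⟨ cong (_+ f (m + n)) (Σ<-split m n f) ⟩
  Σ< m f + Σ< n (λ i → f (m + i)) + f (m + n)      ≡⟨ +-assoc (Σ< m f) _ _ ⟩
  Σ< m f + Σ< (suc n) (λ i → f (m + i))            ∎
  where open ≡-Reasoning

Σ<-radix : ∀ m n f → Σ< (m * n) f ≡ Σ< m (λ i → Σ< n (λ j → f (j + i * n)))
Σ<-radix zero    n f = refl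
Σ<-radix (suc m) n f = begin
  Σ< (n + m * n) f                                     ≡⟨ cong (λ k → Σ< k f) (+-comm n (m * n)) ⟩
  Σ< (m * n + n) f                                     ≡⟨ Σ<-split (m * n) n f ⟩
  Σ< (m * n) f + Σ< n (λ j → f (m * n + j))            ≡⟨ cong₂ _+_ (Σ<-radix m n f) (Σ<-cong n λ j _ → cong f (+-comm (m * n) j)) ⟩
  Σ< (suc m) (λ i → Σ< n (λ j → f (j + i * n)))        ∎
  where open ≡-Reasoning

Σ<-reverse : ∀ n f → Σ< (suc n) f ≡ Σ< (suc n) (λ i → f (n ∸ i))
Σ<-reverse zero    f = refl
Σ<-reverse (suc n) f = begin
  Σ< (suc n) f + f (suc n)                            ≡⟨ cong (_+ f (suc n)) (Σ<-reverse n f) ⟩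
  Σ< (suc n) (λ i → f (n ∸ i)) + f (suc n)            ≡⟨ +-comm _ (f (suc n)) ⟩
  f (suc n) + Σ< (suc n) (λ i → f (n ∸ i))            ≡⟨ Σ<-front (suc n) (λ i → f (suc n ∸ i)) ⟨
  Σ< (suc (suc n)) (λ i → f (suc n ∸ i))              ∎
  where open ≡-Reasoning

-- Iterated partial sums and their inversion

prefix : (ℕ → ℕ) → ℕ → ℕ
prefix f t = Σ< (suc t) f

-- On generating functions this is division by (1-z)^d.
prefix^ : ℕ → (ℕ → ℕ) → ℕ → ℕ
prefix^ zero    f = f
prefix^ (suc d) f = prefix (prefix^ d f)

-- `prefix^` adds its layers on the outside, whereas the induction in `altSum-prefix^` replaces `f`
-- by `prefix f`.
prefix^-inner : ∀ d f t → prefix^ (suc d) f t ≡ prefix^ d (prefix f) t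
prefix^-inner zero    f t = refl
prefix^-inner (suc d) f t = Σ<-cong (suc t) λ i _ → prefix^-inner d f i

prefix^-Σ< : ∀ d n (f : ℕ → ℕ → ℕ) t →
  Σ< n (λ b → prefix^ d (f b) t) ≡ prefix^ d (λ k → Σ< n (λ b → f b k)) t
prefix^-Σ< zero    n f t = refl
prefix^-Σ< (suc d) n f t =
  trans (Σ<-swap n (suc t) _) (Σ<-cong (suc t) λ i _ → prefix^-Σ< d n f i)

x+y-x≡y : ∀ x y → (x ℤ.+ y) ℤ.- x ≡ y
x+y-x≡y = solve-∀ℤ

x+y-y≡x : ∀ x y → (x ℤ.+ y) ℤ.- y ≡ x
x+y-y≡x = solve-∀ℤ

-- altSum d L k is the coefficient of z^k in (1-z)^d Σ_t L(t) z^t.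
altTerm : ℕ → (ℕ → ℕ) → ℕ → ℕ → ℤ
altTerm d L k j = sign j ℤ.* (int (d C j) ℤ.* int (L (k ∸ j)))

altSum : ℕ → (ℕ → ℕ) → ℕ → ℤ
altSum d L k = sumUpTo k (altTerm d L k)

sumUpTo-cong : ∀ k {f g : ℕ → ℤ} → (∀ i → f i ≡ g i) → sumUpTo k f ≡ sumUpTo k g
sumUpTo-cong zero    f≗g = f≗g 0
sumUpTo-cong (suc k) f≗g = cong₂ ℤ._+_ (sumUpTo-cong k f≗g) (f≗g (suc k))

sumUpTo-front : ∀ k f → sumUpTo (suc k) f ≡ f 0 ℤ.+ sumUpTo k (f ∘ suc)
sumUpTo-front zero    f = refl
sumUpTo-front (suc k) f =
  trans (cong (ℤ._+ f (suc (suc k))) (sumUpTo-front k f)) (ℤ.+-assoc (f 0) _ _)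

sumUpTo-minus : ∀ k f g → sumUpTo k (λ i → f i ℤ.- g i) ≡ sumUpTo k f ℤ.- sumUpTo k g
sumUpTo-minus zero    f g = refl
sumUpTo-minus (suc k) f g =
  trans (cong (ℤ._+ (f (suc k) ℤ.- g (suc k))) (sumUpTo-minus k f g)) (interchange (sumUpTo k f) (sumUpTo k g) _ _)
  where
  interchange : ∀ a b c d → (a ℤ.- b) ℤ.+ (c ℤ.- d) ≡ (a ℤ.+ c) ℤ.- (b ℤ.+ d)
  interchange = solve-∀ℤ

sumUpTo-zero : ∀ k → sumUpTo k (λ _ → int 0) ≡ int 0
sumUpTo-zero zero    = refl
sumUpTo-zero (suc k) = trans (ℤ.+-identityʳ _) (sumUpTo-zero k)

nC0≡1 : ∀ n → n C 0 ≡ 1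
nC0≡1 n = trans (nCk≡nC[n∸k] {n = n} z≤n) (nCn≡1 n)

altTerm-leading : ∀ d L k → altTerm d L k 0 ≡ int (L k)
altTerm-leading d L k = begin
  int 1 ℤ.* (int (d C 0) ℤ.* int (L k))  ≡⟨ ℤ.*-identityˡ (int (d C 0) ℤ.* int (L k)) ⟩
  int (d C 0) ℤ.* int (L k)              ≡⟨ cong (λ c → int c ℤ.* int (L k)) (nC0≡1 d) ⟩
  int 1 ℤ.* int (L k)                    ≡⟨ ℤ.*-identityˡ (int (L k)) ⟩
  int (L k)                              ∎
  where open ≡-Reasoning

altSum-zero : ∀ L k → altSum 0 L k ≡ int (L k)
altSum-zero L zero    = altTerm-leading 0 L 0
altSum-zero L (suc k) = begin
  altSum 0 L (suc k)
    ≡⟨ sumUpTo-front k (altTerm 0 L (suc k)) ⟩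
  altTerm 0 L (suc k) 0 ℤ.+ sumUpTo k (altTerm 0 L (suc k) ∘ suc)
    ≡⟨ cong₂ ℤ._+_ (altTerm-leading 0 L (suc k)) (sumUpTo-cong k λ j → ℤ.*-zeroʳ (sign (suc j))) ⟩
  int (L (suc k)) ℤ.+ sumUpTo k (λ _ → int 0)
    ≡⟨ cong (int (L (suc k)) ℤ.+_) (sumUpTo-zero k) ⟩
  int (L (suc k)) ℤ.+ int 0
    ≡⟨ ℤ.+-identityʳ _ ⟩
  int (L (suc k)) ∎
  where open ≡-Reasoning

-- The extra factor 1-z takes a difference of consecutive coefficients. Pascal's rule gives it for
-- the terms with j > 0; the term j = 0 is split off first, as it is the same on both sides.
altSum-suc : ∀ d L k → altSum (suc d) L (suc k) ≡ altSum d L (suc k) ℤ.- altSum d L k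
altSum-suc d L k = begin
  altSum (suc d) L (suc k)
    ≡⟨ sumUpTo-front k (altTerm (suc d) L (suc k)) ⟩
  altTerm (suc d) L (suc k) 0 ℤ.+ sumUpTo k (altTerm (suc d) L (suc k) ∘ suc)
    ≡⟨ cong₂ ℤ._+_ same-leading (sumUpTo-cong k pascal) ⟩
  altTerm d L (suc k) 0 ℤ.+ sumUpTo k (λ j → upper j ℤ.- altTerm d L k j)
    ≡⟨ cong (altTerm d L (suc k) 0 ℤ.+_) (sumUpTo-minus k upper (altTerm d L k)) ⟩
  altTerm d L (suc k) 0 ℤ.+ (sumUpTo k upper ℤ.- altSum d L k)
    ≡⟨ ℤ.+-assoc (altTerm d L (suc k) 0) (sumUpTo k upper) (ℤ.- altSum d L k) ⟨
  (altTerm d L (suc k) 0 ℤ.+ sumUpTo k upper) ℤ.- altSum d L k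
    ≡⟨ cong (ℤ._- altSum d L k) (sumUpTo-front k (altTerm d L (suc k))) ⟨
  altSum d L (suc k) ℤ.- altSum d L k ∎
  where
  open ≡-Reasoning
  upper : ℕ → ℤ
  upper = altTerm d L (suc k) ∘ suc

  same-leading : altTerm (suc d) L (suc k) 0 ≡ altTerm d L (suc k) 0
  same-leading = trans (altTerm-leading (suc d) L (suc k)) (sym (altTerm-leading d L (suc k)))

  expand : ∀ s a b l → (ℤ.- s) ℤ.* ((a ℤ.+ b) ℤ.* l) ≡ (ℤ.- s) ℤ.* (b ℤ.* l) ℤ.- s ℤ.* (a ℤ.* l)
  expand = solve-∀ℤ

  pascal : ∀ j → altTerm (suc d) L (suc k) (suc j) ≡ upper j ℤ.- altTerm d L k j
  pascal j = trans
    (cong (λ c → sign (suc j) ℤ.* (int c ℤ.* int (L (k ∸ j)))) (sym (nCk+nC[k+1]≡[n+1]C[k+1] d j)))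
    (expand (sign j) (int (d C j)) (int (d C suc j)) (int (L (k ∸ j))))

altSum-prefix^ : ∀ d L f → (∀ t → L t ≡ prefix^ d f t) → ∀ k → altSum d L k ≡ int (f k)
altSum-prefix^ zero    L f L≗f k = trans (altSum-zero L k) (cong int (L≗f k))
altSum-prefix^ (suc d) L f L≗f k = difference k
  where
  ih : ∀ k → altSum d L k ≡ int (prefix f k)
  ih = altSum-prefix^ d L (prefix f) λ t → trans (L≗f t) (prefix^-inner d f t)

  difference : ∀ k → altSum (suc d) L k ≡ int (f k)
  difference zero    = trans (altTerm-leading (suc d) L 0) (trans (sym (altTerm-leading d L 0)) (ih 0))
  difference (suc k) = trans (altSum-suc d L k) (trans (cong₂ ℤ._-_ (ih (suc k)) (ih k)) (x+y-x≡y (int (prefix f k)) (int (f (suc k)))))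

-- Lattice points of the dilates

toℚᵘ-ℤ→ℚ : ∀ z → ℚ.toℚᵘ (ℤ→ℚ z) ℚᵘ.≃ ℚᵘ.mkℚᵘ z 0
toℚᵘ-ℤ→ℚ z = ℚ.toℚᵘ-fromℚᵘ (ℚᵘ.mkℚᵘ z 0)

ℤ→ℚ-+ : ∀ x y → ℤ→ℚ (x ℤ.+ y) ≡ ℤ→ℚ x ℚ.+ ℤ→ℚ y
ℤ→ℚ-+ x y = ℚ.toℚᵘ-injective (ℚᵘ.≃-trans (toℚᵘ-ℤ→ℚ (x ℤ.+ y)) (ℚᵘ.≃-trans (ℚᵘ.*≡* (numerators x y))
  (ℚᵘ.≃-sym (ℚᵘ.≃-trans (ℚ.toℚᵘ-homo-+ (ℤ→ℚ x) (ℤ→ℚ y)) (ℚᵘ.+-cong (toℚᵘ-ℤ→ℚ x) (toℚᵘ-ℤ→ℚ y))))))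
  where
  numerators : ∀ x y → (x ℤ.+ y) ℤ.* int 1 ≡ (x ℤ.* int 1 ℤ.+ y ℤ.* int 1) ℤ.* int 1
  numerators = solve-∀ℤ

ℤ→ℚ-* : ∀ x y → ℤ→ℚ (x ℤ.* y) ≡ ℤ→ℚ x ℚ.* ℤ→ℚ y
ℤ→ℚ-* x y = ℚ.toℚᵘ-injective (ℚᵘ.≃-trans (toℚᵘ-ℤ→ℚ (x ℤ.* y)) (ℚᵘ.≃-sym
  (ℚᵘ.≃-trans (ℚ.toℚᵘ-homo-* (ℤ→ℚ x) (ℤ→ℚ y)) (ℚᵘ.*-cong (toℚᵘ-ℤ→ℚ x) (toℚᵘ-ℤ→ℚ y)))))

ℤ→ℚ-nonNeg : ∀ {z} → int 0 ℤ.≤ z → 0ℚ ℚ.≤ ℤ→ℚ z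
ℤ→ℚ-nonNeg {int n} _ = ℚ.nonNegative⁻¹ _ {{ℚ.normalize-nonNeg n 1}}

ℤ→ℚ-nonNeg⁻¹ : ∀ {z} → 0ℚ ℚ.≤ ℤ→ℚ z → int 0 ℤ.≤ z
ℤ→ℚ-nonNeg⁻¹ {z} 0≤z with ℚᵘ.≤-respʳ-≃ (toℚᵘ-ℤ→ℚ z) (ℚ.toℚᵘ-mono-≤ 0≤z)
... | ℚᵘ.*≤* le = subst (int 0 ℤ.≤_) (ℤ.*-identityʳ z) le

ℕ→ℚ-pos : ∀ n → ℚ.Positive (ℕ→ℚ (suc n))
ℕ→ℚ-pos n = ℚ.normalize-pos (suc n) 1

nonNeg-*-pos : ∀ {p} n → 0ℚ ℚ.≤ p → 0ℚ ℚ.≤ p ℚ.* ℕ→ℚ (suc n)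
nonNeg-*-pos {p} n 0≤p = subst (ℚ._≤ p ℚ.* ℕ→ℚ (suc n)) (ℚ.*-zeroˡ (ℕ→ℚ (suc n)))
  (ℚ.*-monoʳ-≤-nonNeg (ℕ→ℚ (suc n)) {{ℚ.normalize-nonNeg (suc n) 1}} 0≤p)

nonNeg-*-pos⁻¹ : ∀ {p} n → 0ℚ ℚ.≤ p ℚ.* ℕ→ℚ (suc n) → 0ℚ ℚ.≤ p
nonNeg-*-pos⁻¹ {p} n 0≤pn = ℚ.*-cancelʳ-≤-pos (ℕ→ℚ (suc n)) {{ℕ→ℚ-pos n}}
  (subst (ℚ._≤ p ℚ.* ℕ→ℚ (suc n)) (sym (ℚ.*-zeroˡ (ℕ→ℚ (suc n)))) 0≤pn)

p+q-q≡p : ∀ p q → (p ℚ.+ q) ℚ.- q ≡ p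
p+q-q≡p = solve 2 (λ p q → (p :+ q) :- q := p) refl
  where open +-*-Solver using (solve; _:+_; _:-_; _:=_)

sumℤ : ∀ {n} → Vec ℤ n → ℤ
sumℤ []      = int 0
sumℤ (x ∷ p) = x ℤ.+ sumℤ p

sum-barycentric : ∀ {n} (q : Vec ℕ n) (p : Vec ℤ n) (ν : Fin n → ℚ) μ₀ →
  (∀ i → ℤ→ℚ (lookup p i) ≡ ν i ℚ.- μ₀ ℚ.* ℕ→ℚ (lookup q i)) →
  sumℚ n ν ≡ ℤ→ℚ (sumℤ p) ℚ.+ μ₀ ℚ.* ℕ→ℚ (Vec.sum q)
sum-barycentric []      []      ν μ₀ eqs = sym (trans (ℚ.+-identityˡ _) (ℚ.*-zeroʳ μ₀))
sum-barycentric (r ∷ q) (x ∷ p) ν μ₀ eqs = begin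
  ν zero ℚ.+ sumℚ _ (ν ∘ suc)
    ≡⟨ cong (ν zero ℚ.+_) (sum-barycentric q p (ν ∘ suc) μ₀ (eqs ∘ suc)) ⟩
  ν zero ℚ.+ (ℤ→ℚ (sumℤ p) ℚ.+ μ₀ ℚ.* ℕ→ℚ (Vec.sum q))
    ≡⟨ regroup (ν zero) (ℤ→ℚ (sumℤ p)) μ₀ (ℕ→ℚ (Vec.sum q)) (ℕ→ℚ r) ⟩
  ((ν zero ℚ.- μ₀ ℚ.* ℕ→ℚ r) ℚ.+ ℤ→ℚ (sumℤ p)) ℚ.+ μ₀ ℚ.* (ℕ→ℚ r ℚ.+ ℕ→ℚ (Vec.sum q))
    ≡⟨ cong₂ (λ y s → (y ℚ.+ ℤ→ℚ (sumℤ p)) ℚ.+ μ₀ ℚ.* s) (sym (eqs zero)) (sym (ℤ→ℚ-+ (int r) (int (Vec.sum q)))) ⟩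
  (ℤ→ℚ x ℚ.+ ℤ→ℚ (sumℤ p)) ℚ.+ μ₀ ℚ.* ℕ→ℚ (r + Vec.sum q)
    ≡⟨ cong (ℚ._+ μ₀ ℚ.* ℕ→ℚ (r + Vec.sum q)) (ℤ→ℚ-+ x (sumℤ p)) ⟨
  ℤ→ℚ (x ℤ.+ sumℤ p) ℚ.+ μ₀ ℚ.* ℕ→ℚ (r + Vec.sum q) ∎
  where
  open ≡-Reasoning
  open +-*-Solver using (solve; _:+_; _:*_; _:-_; _:=_)
  regroup : ∀ v s m a b → v ℚ.+ (s ℚ.+ m ℚ.* a) ≡ ((v ℚ.- m ℚ.* b) ℚ.+ s) ℚ.+ m ℚ.* (b ℚ.+ a)
  regroup = solve 5 (λ v s m a b → v :+ (s :+ m :* a) := ((v :- m :* b) :+ s) :+ m :* (b :+ a)) refl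

-- The coefficient of -q itself adds 1 to Σ qᵢ, which is the origin of Q. Since the total is t, the
-- point determines μ₀ Q = t - Σ pᵢ, an integer.
sum-all-barycentric : ∀ {n} (q : Vec ℕ n) (p : Vec ℤ n) (μ : Fin (suc n) → ℚ) →
  (∀ i → ℤ→ℚ (lookup p i) ≡ μ (suc i) ℚ.- μ zero ℚ.* ℕ→ℚ (lookup q i)) →
  sumℚ (suc n) μ ≡ ℤ→ℚ (sumℤ p) ℚ.+ μ zero ℚ.* ℕ→ℚ (suc (Vec.sum q))
sum-all-barycentric q p μ eqs = begin
  μ zero ℚ.+ sumℚ _ (μ ∘ suc)
    ≡⟨ cong (μ zero ℚ.+_) (sum-barycentric q p (μ ∘ suc) (μ zero) eqs) ⟩
  μ zero ℚ.+ (ℤ→ℚ (sumℤ p) ℚ.+ μ zero ℚ.* ℕ→ℚ (Vec.sum q))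
    ≡⟨ regroup (μ zero) (ℤ→ℚ (sumℤ p)) (ℕ→ℚ (Vec.sum q)) ⟩
  ℤ→ℚ (sumℤ p) ℚ.+ μ zero ℚ.* (1ℚ ℚ.+ ℕ→ℚ (Vec.sum q))
    ≡⟨ cong (λ s → ℤ→ℚ (sumℤ p) ℚ.+ μ zero ℚ.* s) (ℤ→ℚ-+ (int 1) (int (Vec.sum q))) ⟨
  ℤ→ℚ (sumℤ p) ℚ.+ μ zero ℚ.* ℕ→ℚ (suc (Vec.sum q)) ∎
  where
  open ≡-Reasoning
  open +-*-Solver using (solve; _:+_; _:*_; con; _:=_)
  regroup : ∀ m s a → m ℚ.+ (s ℚ.+ m ℚ.* a) ≡ s ℚ.+ m ℚ.* (1ℚ ℚ.+ a)
  regroup = solve 3 (λ m s a → m :+ (s :+ m :* a) := s :+ m :* (con 1ℚ :+ a)) refl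

-- Integral description of the dilate: m is Q times the barycentric coordinate of −q.
InDilateℤ : (n : ℕ) → Vec ℕ n → ℕ → Vec ℤ n → Set
InDilateℤ n q t p = Σ ℕ λ m → (sumℤ p ℤ.+ int m ≡ int t) ×
  (∀ i → int 0 ℤ.≤ lookup p i ℤ.* int (suc (Vec.sum q)) ℤ.+ int (m * lookup q i))

-- With μ₀ = m / s the coefficient of a unit vector is x + m r / s, so multiplication by s clears
-- its denominator.
scaled-coordinate : ∀ s m μ₀ r x ν → ℤ→ℚ x ≡ ν ℚ.- μ₀ ℚ.* ℕ→ℚ r → μ₀ ℚ.* ℕ→ℚ s ≡ ℕ→ℚ m →
  ν ℚ.* ℕ→ℚ s ≡ ℤ→ℚ (x ℤ.* int s ℤ.+ int (m * r))
scaled-coordinate s m μ₀ r x ν x≡ μ₀s≡m = begin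
  ν ℚ.* ℕ→ℚ s
    ≡⟨ regroup ν (ℕ→ℚ s) μ₀ (ℕ→ℚ r) ⟩
  (ν ℚ.- μ₀ ℚ.* ℕ→ℚ r) ℚ.* ℕ→ℚ s ℚ.+ (μ₀ ℚ.* ℕ→ℚ s) ℚ.* ℕ→ℚ r
    ≡⟨ cong₂ (λ a b → a ℚ.* ℕ→ℚ s ℚ.+ b ℚ.* ℕ→ℚ r) (sym x≡) μ₀s≡m ⟩
  ℤ→ℚ x ℚ.* ℕ→ℚ s ℚ.+ ℕ→ℚ m ℚ.* ℕ→ℚ r
    ≡⟨ cong₂ ℚ._+_ (ℤ→ℚ-* x (int s)) (trans (cong ℤ→ℚ (ℤ.pos-* m r)) (ℤ→ℚ-* (int m) (int r))) ⟨
  ℤ→ℚ (x ℤ.* int s) ℚ.+ ℕ→ℚ (m * r)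
    ≡⟨ ℤ→ℚ-+ (x ℤ.* int s) (int (m * r)) ⟨
  ℤ→ℚ (x ℤ.* int s ℤ.+ int (m * r)) ∎
  where
  open ≡-Reasoning
  open +-*-Solver using (solve; _:+_; _:*_; _:-_; _:=_)
  regroup : ∀ v s m a → v ℚ.* s ≡ (v ℚ.- m ℚ.* a) ℚ.* s ℚ.+ (m ℚ.* s) ℚ.* a
  regroup = solve 4 (λ v s m a → v :* s := (v :- m :* a) :* s :+ (m :* s) :* a) refl

InDilate⇒InDilateℤ : ∀ n q t p → InDilate n q t p → InDilateℤ n q t p
InDilate⇒InDilateℤ n q t p (μ , 0≤μ , sumμ≡t , eqs) = witness (int t ℤ.- sumℤ p) refl 0≤z
  where
  open ≡-Reasoning
  Q = suc (Vec.sum q)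

  z≡ : ℤ→ℚ (int t ℤ.- sumℤ p) ≡ μ zero ℚ.* ℕ→ℚ Q
  z≡ = begin
    ℤ→ℚ (int t ℤ.- sumℤ p)                       ≡⟨ p+q-q≡p (ℤ→ℚ (int t ℤ.- sumℤ p)) (ℤ→ℚ (sumℤ p)) ⟨
    (ℤ→ℚ (int t ℤ.- sumℤ p) ℚ.+ ℤ→ℚ (sumℤ p)) ℚ.- ℤ→ℚ (sumℤ p)
      ≡⟨ cong (ℚ._- ℤ→ℚ (sumℤ p)) (ℤ→ℚ-+ (int t ℤ.- sumℤ p) (sumℤ p)) ⟨
    ℤ→ℚ ((int t ℤ.- sumℤ p) ℤ.+ sumℤ p) ℚ.- ℤ→ℚ (sumℤ p)
      ≡⟨ cong (λ y → ℤ→ℚ y ℚ.- ℤ→ℚ (sumℤ p)) (cancelℤ (int t) (sumℤ p)) ⟩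
    ℕ→ℚ t ℚ.- ℤ→ℚ (sumℤ p)
      ≡⟨ cong (ℚ._- ℤ→ℚ (sumℤ p)) (trans (sym sumμ≡t) (sum-all-barycentric q p μ eqs)) ⟩
    (ℤ→ℚ (sumℤ p) ℚ.+ μ zero ℚ.* ℕ→ℚ Q) ℚ.- ℤ→ℚ (sumℤ p)
      ≡⟨ cancel (ℤ→ℚ (sumℤ p)) (μ zero ℚ.* ℕ→ℚ Q) ⟩
    μ zero ℚ.* ℕ→ℚ Q ∎
    where
    open +-*-Solver using (solve; _:+_; _:-_; _:=_)
    cancel : ∀ a b → (a ℚ.+ b) ℚ.- a ≡ b
    cancel = solve 2 (λ a b → (a :+ b) :- a := b) refl
    cancelℤ : ∀ a b → (a ℤ.- b) ℤ.+ b ≡ a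
    cancelℤ = solve-∀ℤ

  0≤z : int 0 ℤ.≤ int t ℤ.- sumℤ p
  0≤z = ℤ→ℚ-nonNeg⁻¹ (subst (0ℚ ℚ.≤_) (sym z≡) (nonNeg-*-pos (Vec.sum q) (0≤μ zero)))

  -- The integer t - Σ pᵢ is passed with its equation and its sign so that it can be matched as a
  -- natural number.
  witness : ∀ z → z ≡ int t ℤ.- sumℤ p → int 0 ℤ.≤ z → InDilateℤ n q t p
  witness (int m) m≡ _ = m
    , trans (cong (sumℤ p ℤ.+_) m≡) (cancelℤ (sumℤ p) (int t))
    , λ i → ℤ→ℚ-nonNeg⁻¹ (subst (0ℚ ℚ.≤_)
        (scaled-coordinate Q m (μ zero) (lookup q i) (lookup p i) (μ (suc i)) (eqs i)
          (trans (sym z≡) (cong ℤ→ℚ (sym m≡))))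
        (nonNeg-*-pos (Vec.sum q) (0≤μ (suc i))))
    where
    cancelℤ : ∀ a b → a ℤ.+ (b ℤ.- a) ≡ b
    cancelℤ = solve-∀ℤ

InDilateℤ⇒InDilate : ∀ n q t p → InDilateℤ n q t p → InDilate n q t p
InDilateℤ⇒InDilate n q t p (m , sum≡ , 0≤) = μ , 0≤μ , sumμ , eqs
  where
  open ≡-Reasoning
  Q = suc (Vec.sum q)

  instance
    Q≢0 : ℚ.NonZero (ℕ→ℚ Q)
    Q≢0 = ℚ.pos⇒nonZero (ℕ→ℚ Q) {{ℕ→ℚ-pos (Vec.sum q)}}

  μ : Fin (suc n) → ℚ
  μ zero    = ℕ→ℚ m ℚ.* ℚ.1/ ℕ→ℚ Q
  μ (suc i) = ℤ→ℚ (lookup p i) ℚ.+ μ zero ℚ.* ℕ→ℚ (lookup q i)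

  μ₀Q≡m : μ zero ℚ.* ℕ→ℚ Q ≡ ℕ→ℚ m
  μ₀Q≡m = trans (ℚ.*-assoc (ℕ→ℚ m) _ _)
    (trans (cong (ℕ→ℚ m ℚ.*_) (ℚ.*-inverseˡ (ℕ→ℚ Q))) (ℚ.*-identityʳ (ℕ→ℚ m)))

  eqs : ∀ i → ℤ→ℚ (lookup p i) ≡ μ (suc i) ℚ.- μ zero ℚ.* ℕ→ℚ (lookup q i)
  eqs i = sym (p+q-q≡p (ℤ→ℚ (lookup p i)) (μ zero ℚ.* ℕ→ℚ (lookup q i)))

  0≤μ : ∀ j → 0ℚ ℚ.≤ μ j
  0≤μ zero    = nonNeg-*-pos⁻¹ (Vec.sum q) (subst (0ℚ ℚ.≤_) (sym μ₀Q≡m) (ℤ→ℚ-nonNeg {int m} (ℤ.+≤+ z≤n)))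
  0≤μ (suc i) = nonNeg-*-pos⁻¹ (Vec.sum q) (subst (0ℚ ℚ.≤_)
    (sym (scaled-coordinate Q m (μ zero) (lookup q i) (lookup p i) (μ (suc i)) (eqs i) μ₀Q≡m))
    (ℤ→ℚ-nonNeg (0≤ i)))

  sumμ : sumℚ (suc n) μ ≡ ℕ→ℚ t
  sumμ = begin
    sumℚ (suc n) μ                            ≡⟨ sum-all-barycentric q p μ eqs ⟩
    ℤ→ℚ (sumℤ p) ℚ.+ μ zero ℚ.* ℕ→ℚ Q         ≡⟨ cong (ℤ→ℚ (sumℤ p) ℚ.+_) μ₀Q≡m ⟩
    ℤ→ℚ (sumℤ p) ℚ.+ ℕ→ℚ m                    ≡⟨ ℤ→ℚ-+ (sumℤ p) (int m) ⟨
    ℤ→ℚ (sumℤ p ℤ.+ int m)                    ≡⟨ cong ℤ→ℚ sum≡ ⟩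
    ℕ→ℚ t                                     ∎

-- Counting by duplicate-free lists

Enumerates : {A : Set} → List A → (A → Set) → Set
Enumerates {A} xs P = Unique xs × (∀ x → x ∈ xs ⇔ P x)

-- Two duplicate-free lists with the same members agree as bags, hence are permutations of each
-- other. So `L t`, which is given through an unknown list, can be computed from an explicit one.
enumerates-length : ∀ {A : Set} {xs ys : List A} {P : A → Set} →
  Enumerates xs P → Enumerates ys P → length xs ≡ length ys
enumerates-length (xs! , xs⇔P) (ys! , ys⇔P) =
  ↭-length (∼bag⇒↭ (unique∧set⇒bag xs! ys! λ {x} →
    mk⇔ (Equivalence.from (ys⇔P x) ∘ Equivalence.to (xs⇔P x))
        (Equivalence.from (xs⇔P x) ∘ Equivalence.to (ys⇔P x))))

-- Injectivity is asked only on members of the list: `decode` identifies indices once b may reach Q.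
unique-map : ∀ {A B : Set} (f : A → B) {xs} →
  (∀ {x y} → x ∈ xs → y ∈ xs → f x ≡ f y → x ≡ y) → Unique xs → Unique (List.map f xs)
unique-map f inj []          = []
unique-map f inj (x∉ ∷ xs!) =
  All.map⁺ (All.tabulate λ y∈ fx≡fy → All.lookup x∉ y∈ (inj (here refl) (there y∈) fx≡fy))
  ∷ unique-map f (λ x∈ y∈ → inj (there x∈) (there y∈)) xs!

enumerates-map : ∀ {A B : Set} (f : A → B) {xs} {P : A → Set} {R : B → Set} → Enumerates xs P →
  (∀ {x y} → P x → P y → f x ≡ f y → x ≡ y) →
  (∀ {x} → P x → R (f x)) → (∀ y → R y → ∃ λ x → P x × y ≡ f x) →
  Enumerates (List.map f xs) R
enumerates-map f {xs} {P} {R} (xs! , xs⇔P) inj sound complete =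
  unique-map f (λ {x} {y} x∈ y∈ → inj (Equivalence.to (xs⇔P x) x∈) (Equivalence.to (xs⇔P y) y∈)) xs! ,
  λ y → mk⇔ (to y) (from y)
  where
  to : ∀ y → y ∈ List.map f xs → R y
  to y y∈ with ∈-map⁻ f y∈
  ... | x , x∈ , refl = sound (Equivalence.to (xs⇔P x) x∈)
  from : ∀ y → R y → y ∈ List.map f xs
  from y Ry with complete y Ry
  ... | x , Px , refl = ∈-map⁺ f (Equivalence.from (xs⇔P x) Px)

enumerates-++ : ∀ {A : Set} {xs ys : List A} {P R : A → Set} → Enumerates xs P → Enumerates ys R →
  (∀ {x} → P x → ¬ R x) → Enumerates (xs List.++ ys) (λ x → P x ⊎ R x)
enumerates-++ {xs = xs} (xs! , xs⇔P) (ys! , ys⇔R) disjoint =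
  Unique.++⁺ xs! ys! (λ {x} (x∈xs , x∈ys) →
    disjoint (Equivalence.to (xs⇔P x) x∈xs) (Equivalence.to (ys⇔R x) x∈ys)) ,
  λ x → mk⇔ (Sum.map (Equivalence.to (xs⇔P x)) (Equivalence.to (ys⇔R x)) ∘ ∈-++⁻ xs)
            Sum.[ ∈-++⁺ˡ ∘ Equivalence.from (xs⇔P x) , ∈-++⁺ʳ xs ∘ Equivalence.from (ys⇔R x) ]

enumerates-resp : ∀ {A : Set} {xs : List A} {P R : A → Set} → (∀ x → P x ⇔ R x) →
  Enumerates xs P → Enumerates xs R
enumerates-resp P⇔R (xs! , xs⇔P) = xs! , λ x →
  mk⇔ (Equivalence.to (P⇔R x) ∘ Equivalence.to (xs⇔P x)) (Equivalence.from (xs⇔P x) ∘ Equivalence.from (P⇔R x))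

-- The coefficient sequence of the constant 1. It is indexed by ℤ so that multiplication by powers
-- of z is a plain shift, with no truncated subtraction.
δ : ℤ → ℕ
δ (int zero)    = 1
δ (int (suc _)) = 0
δ -[1+ _ ]      = 0

δ-one : ∀ {z} → z ≡ int 0 → δ z ≡ 1
δ-one refl = refl

δ-zero : ∀ z → z ≢ int 0 → δ z ≡ 0
δ-zero (int zero)    z≢0 = contradiction refl z≢0
δ-zero (int (suc _)) z≢0 = refl
δ-zero -[1+ _ ]      z≢0 = refl

-- Vectors of slacks with a prescribed sum

incrementHead : ∀ {n} → Vec ℕ (suc n) → Vec ℕ (suc n)
incrementHead (a ∷ v) = suc a ∷ v

-- The vectors `v` with `w + Vec.sum v ≡ t`, split by whether the head is positive or zero. This is
-- exactly the recursion of `prefix^` in `n` and `t`, so the length is an iterated partial sum.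
compositions : ∀ n → ℕ → ℕ → List (Vec ℕ n)
compositions zero w t with w ≟ t
... | yes _ = [] ∷ []
... | no  _ = []
compositions (suc n) w zero    = List.map (0 ∷_) (compositions n w 0)
compositions (suc n) w (suc t) =
  List.map incrementHead (compositions (suc n) w t) List.++ List.map (0 ∷_) (compositions n w (suc t))

compositions-enumerates : ∀ n w t → Enumerates (compositions n w t) (λ v → w + Vec.sum v ≡ t)
compositions-enumerates zero w t with w ≟ t
... | yes w≡t = [] ∷ [] , λ { [] → mk⇔ (λ _ → trans (+-identityʳ w) w≡t) (λ _ → here refl) }
... | no  w≢t = [] , λ { [] → mk⇔ (λ ()) (λ w+0≡t → contradiction (trans (sym (+-identityʳ w)) w+0≡t) w≢t) }
compositions-enumerates (suc n) w zero =
  enumerates-map (0 ∷_) (compositions-enumerates n w 0) (λ _ _ → ∷-injectiveʳ) id complete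
  where
  complete : ∀ v → w + Vec.sum v ≡ 0 → ∃ λ u → (w + Vec.sum u ≡ 0) × v ≡ 0 ∷ u
  complete (zero  ∷ u) eq = u , eq , refl
  complete (suc a ∷ u) eq = contradiction (trans (sym (+-suc w _)) eq) λ ()
compositions-enumerates (suc n) w (suc t) = enumerates-resp equiv
  (enumerates-++
    -- The conditions put on the head make the two halves disjoint; `equiv` drops them again.
    (enumerates-map incrementHead {R = λ v → (w + Vec.sum v ≡ suc t) × 0 < Vec.head v}
      (compositions-enumerates (suc n) w t)
      (λ { {_ ∷ _} {_ ∷ _} _ _ refl → refl })
      (λ { {a ∷ u} eq → trans (+-suc w _) (cong suc eq) , z<s })
      (λ { (zero ∷ u) (_ , ()) ; (suc a ∷ u) (eq , _) → a ∷ u , suc-injective (trans (sym (+-suc w _)) eq) , refl }))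
    (enumerates-map (0 ∷_) {R = λ v → (w + Vec.sum v ≡ suc t) × Vec.head v ≡ 0}
      (compositions-enumerates n w (suc t))
      (λ _ _ → ∷-injectiveʳ)
      (λ eq → eq , refl)
      (λ { (zero ∷ u) (eq , _) → u , eq , refl }))
    (λ { {zero ∷ _} (_ , ()) ; {suc _ ∷ _} _ (_ , ()) }))
  where
  equiv : ∀ v →
    (((w + Vec.sum v ≡ suc t) × 0 < Vec.head v) ⊎ ((w + Vec.sum v ≡ suc t) × Vec.head v ≡ 0)) ⇔
    (w + Vec.sum v ≡ suc t)
  equiv (zero  ∷ u) = mk⇔ Sum.[ proj₁ , proj₁ ] (λ eq → inj₂ (eq , refl))
  equiv (suc a ∷ u) = mk⇔ Sum.[ proj₁ , proj₁ ] (λ eq → inj₁ (eq , z<s))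

compositions-length : ∀ n w t → length (compositions n w t) ≡ prefix^ n (λ k → δ (int k ℤ.- int w)) t
compositions-length zero w t with w ≟ t
... | yes refl = sym (δ-one (ℤ.+-inverseʳ (int w)))
... | no  w≢t = sym (δ-zero _ (λ t-w≡0 → w≢t (sym (ℤ.+-injective (ℤ.i-j≡0⇒i≡j (int t) (int w) t-w≡0)))))
compositions-length (suc n) w zero =
  trans (length-map (0 ∷_) (compositions n w 0)) (compositions-length n w 0)
compositions-length (suc n) w (suc t) = trans
  (length-++ (List.map incrementHead (compositions (suc n) w t)))
  (cong₂ _+_
    (trans (length-map incrementHead (compositions (suc n) w t)) (compositions-length (suc n) w t))
    (trans (length-map (0 ∷_) (compositions n w (suc t))) (compositions-length n w (suc t))))

-- Later the vector is `k ∷ a`, with one entry more than the dimension, which accounts for the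
-- exponent n + 1 of 1 - z in the Ehrhart series.
weightedCompositions : ∀ n → (ℕ → ℕ) → ℕ → ℕ → List (ℕ × Vec ℕ n)
weightedCompositions n w t zero    = []
weightedCompositions n w t (suc B) =
  weightedCompositions n w t B List.++ List.map (B ,_) (compositions n (w B) t)

weightedCompositions-enumerates : ∀ n w t B →
  Enumerates (weightedCompositions n w t B) (λ (b , v) → b < B × w b + Vec.sum v ≡ t)
weightedCompositions-enumerates n w t zero    = [] , λ _ → mk⇔ (λ ()) (λ ())
weightedCompositions-enumerates n w t (suc B) = enumerates-resp (λ x → mk⇔ to from)
  (enumerates-++ (weightedCompositions-enumerates n w t B)
    (enumerates-map (B ,_) {R = λ (b , v) → b ≡ B × w b + Vec.sum v ≡ t} (compositions-enumerates n (w B) t)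
      (λ { _ _ refl → refl }) (refl ,_) (λ { (_ , v) (refl , eq) → v , eq , refl }))
    (λ { (b<B , _) (refl , _) → n≮n _ b<B }))
  where
  to : ∀ {b} {S : Set} → (b < B × S) ⊎ (b ≡ B × S) → b < suc B × S
  to (inj₁ (b<B  , s)) = m<n⇒m<1+n b<B , s
  to (inj₂ (refl , s)) = n<1+n B , s
  from : ∀ {b} {S : Set} → b < suc B × S → (b < B × S) ⊎ (b ≡ B × S)
  from (b<1+B , s) with m<1+n⇒m<n∨m≡n b<1+B
  ... | inj₁ b<B = inj₁ (b<B , s)
  ... | inj₂ b≡B = inj₂ (b≡B , s)

weightedCompositions-length : ∀ n w t B →
  length (weightedCompositions n w t B) ≡ Σ< B (λ b → prefix^ n (λ k → δ (int k ℤ.- int (w b))) t)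
weightedCompositions-length n w t zero    = refl
weightedCompositions-length n w t (suc B) = trans
  (length-++ (weightedCompositions n w t B))
  (cong₂ _+_ (weightedCompositions-length n w t B)
    (trans (length-map (B ,_) (compositions n (w B) t)) (compositions-length n (w B) t)))

-- Weights and coordinates on the lattice points

floorSum : ∀ {n} (s : ℕ) .{{_ : NonZero s}} → Vec ℕ n → ℕ → ℕ
floorSum s []      b = 0
floorSum s (r ∷ q) b = b * r / s + floorSum s q b

floorSum-* : ∀ {n} s .{{_ : NonZero s}} (q : Vec ℕ n) b → floorSum s q b * s ≤ b * Vec.sum q
floorSum-* s []      b = z≤n
floorSum-* s (r ∷ q) b = begin
  (b * r / s + floorSum s q b) * s       ≡⟨ *-distribʳ-+ s (b * r / s) (floorSum s q b) ⟩
  b * r / s * s + floorSum s q b * s     ≤⟨ +-mono-≤ (m/n*n≤m (b * r) s) (floorSum-* s q b) ⟩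
  b * r + b * Vec.sum q                  ≡⟨ *-distribˡ-+ b r (Vec.sum q) ⟨
  b * (r + Vec.sum q)                    ∎
  where open ≤-Reasoning

volume : ∀ {n} → Vec ℕ n → ℕ
volume q = suc (Vec.sum q)

weight : ∀ {n} → Vec ℕ n → ℕ → ℕ
weight q b = b ∸ floorSum (volume q) q b

-- The floors sum to at most b Σ qᵢ / Q, which is at most b. Hence the truncated subtraction in
-- `weight` loses nothing.
floorSum≤ : ∀ {n} (q : Vec ℕ n) b → floorSum (volume q) q b ≤ b
floorSum≤ q b = *-cancelʳ-≤ _ _ (volume q)
  (≤-trans (floorSum-* (volume q) q b) (*-monoʳ-≤ b (n≤1+n (Vec.sum q))))

weight+floorSum : ∀ {n} (q : Vec ℕ n) b → weight q b + floorSum (volume q) q b ≡ b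
weight+floorSum q b = m∸n+n≡m (floorSum≤ q b)

-- The point a − ⌊m q / s⌋, where m = b + k s and a ∈ ℕⁿ.
point : ∀ {n} s .{{_ : NonZero s}} → Vec ℕ n → ℕ → ℕ → Vec ℕ n → Vec ℤ n
point s []      b k []      = []
point s (r ∷ q) b k (a ∷ v) = int a ℤ.- int (k * r + b * r / s) ∷ point s q b k v

sum-point : ∀ {n} s .{{_ : NonZero s}} (q : Vec ℕ n) b k a →
  sumℤ (point s q b k a) ≡ int (Vec.sum a) ℤ.- int (k * Vec.sum q + floorSum s q b)
sum-point s []      b k []      = sym (cong (λ z → int 0 ℤ.- int z) (trans (+-identityʳ (k * 0)) (*-zeroʳ k)))
sum-point s (r ∷ q) b k (a ∷ v) = trans
  (cong (int a ℤ.- int (k * r + b * r / s) ℤ.+_) (sum-point s q b k v))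
  (trans (interchange (int a) (int (k * r + b * r / s)) (int (Vec.sum v)) (int (k * Vec.sum q + floorSum s q b)))
    (cong (λ z → int (a + Vec.sum v) ℤ.- int z) (regroup k r (b * r / s) (Vec.sum q) (floorSum s q b))))
  where
  interchange : ∀ a b c d → (a ℤ.- b) ℤ.+ (c ℤ.- d) ≡ (a ℤ.+ c) ℤ.- (b ℤ.+ d)
  interchange = solve-∀ℤ
  regroup : ∀ k r x q y → (k * r + x) + (k * q + y) ≡ k * (r + q) + (x + y)
  regroup = solve-∀

point-injective : ∀ {n} s .{{_ : NonZero s}} (q : Vec ℕ n) b k {a a′} →
  point s q b k a ≡ point s q b k a′ → a ≡ a′
point-injective s []      b k {[]}    {[]}     eq = refl
point-injective s (r ∷ q) b k {a ∷ v} {a′ ∷ v′} eq =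
  cong₂ _∷_ (ℤ.+-injective (∙-cancelʳ (ℤ.- int (k * r + b * r / s)) (int a) (int a′) (∷-injectiveˡ eq)))
            (point-injective s q b k (∷-injectiveʳ eq))

-- For m = b + k s the floor of m r / s is k r + ⌊b r / s⌋, so only the remainder of b r survives.
-- As it lies in [0, s), the inequality of `InDilateℤ` says just that the slack is nonnegative.
scaled-point : ∀ s .{{_ : NonZero s}} b k r x →
  (x ℤ.- int (k * r + b * r / s)) ℤ.* int s ℤ.+ int ((b + k * s) * r) ≡ x ℤ.* int s ℤ.+ int ((b * r) % s)
scaled-point s b k r x = trans
  (cong (λ z → (x ℤ.- int (k * r + b * r / s)) ℤ.* int s ℤ.+ z)
    (trans (cong int numerator) (cong (ℤ._+ int (b * r % s)) (ℤ.pos-* (k * r + b * r / s) s))))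
  (cancel x (int (k * r + b * r / s)) (int s) (int (b * r % s)))
  where
  open ≡-Reasoning
  regroup : ∀ k r s f g → k * s * r + (g + f * s) ≡ (k * r + f) * s + g
  regroup = solve-∀
  distrib : ∀ b k s r → (b + k * s) * r ≡ k * s * r + b * r
  distrib = solve-∀
  numerator : (b + k * s) * r ≡ (k * r + b * r / s) * s + b * r % s
  numerator = begin
    (b + k * s) * r                             ≡⟨ distrib b k s r ⟩
    k * s * r + b * r                           ≡⟨ cong (k * s * r ℕ.+_) (m≡m%n+[m/n]*n (b * r) s) ⟩
    k * s * r + (b * r % s + b * r / s * s)     ≡⟨ regroup k r s (b * r / s) (b * r % s) ⟩
    (k * r + b * r / s) * s + b * r % s         ∎
  cancel : ∀ x y s g → (x ℤ.- y) ℤ.* s ℤ.+ (y ℤ.* s ℤ.+ g) ≡ x ℤ.* s ℤ.+ g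
  cancel = solve-∀ℤ

point-nonNeg : ∀ {n} s .{{_ : NonZero s}} (q : Vec ℕ n) b k a i →
  int 0 ℤ.≤ lookup (point s q b k a) i ℤ.* int s ℤ.+ int ((b + k * s) * lookup q i)
point-nonNeg s (r ∷ q) b k (a ∷ v) zero = subst (int 0 ℤ.≤_)
  (sym (trans (scaled-point s b k r (int a)) (cong (ℤ._+ int (b * r % s)) (sym (ℤ.pos-* a s)))))
  (ℤ.+≤+ z≤n)
point-nonNeg s (r ∷ q) b k (a ∷ v) (suc i) = point-nonNeg s q b k v i

-- A value y ≤ -1 would give y s + g ≤ g - s < 0.
quotient-nonNeg : ∀ s .{{_ : NonZero s}} y g → g < s → int 0 ℤ.≤ y ℤ.* int s ℤ.+ int g → int 0 ℤ.≤ y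
quotient-nonNeg s (int _) g g<s _ = ℤ.+≤+ z≤n
quotient-nonNeg s -[1+ n ] g g<s 0≤ = contradiction (ℤ.drop‿+≤+ n*s≤g) (<⇒≱ (<-≤-trans g<s (m≤m+n s (n * s))))
  where
  cancel : ∀ x s g → x ℤ.* s ℤ.+ ((ℤ.- x) ℤ.* s ℤ.+ g) ≡ g
  cancel = solve-∀ℤ
  n*s≤g : int (suc n * s) ℤ.≤ int g
  n*s≤g = subst₂ ℤ._≤_ (trans (ℤ.+-identityʳ _) (sym (ℤ.pos-* (suc n) s))) (cancel (int (suc n)) (int s) (int g))
    (ℤ.+-monoʳ-≤ (int (suc n) ℤ.* int s) 0≤)

point-surjective : ∀ {n} s .{{_ : NonZero s}} (q : Vec ℕ n) b k p →
  (∀ i → int 0 ℤ.≤ lookup p i ℤ.* int s ℤ.+ int ((b + k * s) * lookup q i)) → ∃ λ a → p ≡ point s q b k a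
point-surjective s []      b k []      0≤ = [] , refl
point-surjective s (r ∷ q) b k (x ∷ p) 0≤ = prepend (x ℤ.+ int c) refl nonNeg (point-surjective s q b k p (0≤ ∘ suc))
  where
  c = k * r + b * r / s
  nonNeg : int 0 ℤ.≤ x ℤ.+ int c
  nonNeg = quotient-nonNeg s _ (b * r % s) (m%n<n (b * r) s) (subst (int 0 ℤ.≤_)
    (trans (cong (λ z → z ℤ.* int s ℤ.+ int ((b + k * s) * r)) (sym (x+y-y≡x x (int c))))
      (scaled-point s b k r (x ℤ.+ int c)))
    (0≤ zero))
  prepend : ∀ y → y ≡ x ℤ.+ int c → int 0 ℤ.≤ y → (∃ λ a → p ≡ point s q b k a) →
    ∃ λ a → x ∷ p ≡ point s (r ∷ q) b k a
  prepend (int a) y≡ _ (v , refl) =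
    a ∷ v , cong (_∷ _) (sym (trans (cong (ℤ._- int c) y≡) (x+y-y≡x x (int c))))

-- Since Q = 1 + Σ qᵢ, the terms k Q and -k Σ qᵢ leave k, while b minus its floors is w(b). This
-- gives the dilate t on which the point has index (b , k , a).
point-level : ∀ {n} (q : Vec ℕ n) b k a →
  sumℤ (point (volume q) q b k a) ℤ.+ int (b + k * volume q) ≡ int (weight q b + (k + Vec.sum a))
point-level q b k a = begin
  sumℤ (point s q b k a) ℤ.+ int (b + k * s)
    ≡⟨ cong (ℤ._+ int (b + k * s)) (sum-point s q b k a) ⟩
  (int (Vec.sum a) ℤ.- int (k * Vec.sum q + F)) ℤ.+ int (b + k * s)
    ≡⟨ commute (int (Vec.sum a)) (int (k * Vec.sum q + F)) (int (b + k * s)) ⟩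
  int (Vec.sum a + (b + k * s)) ℤ.- int (k * Vec.sum q + F)
    ≡⟨ cong (λ z → int z ℤ.- int (k * Vec.sum q + F))
         (trans (cong (λ z → Vec.sum a + (z + k * s)) (sym (weight+floorSum q b)))
           (regroup (Vec.sum a) (weight q b) F k (Vec.sum q))) ⟩
  int ((k * Vec.sum q + F) + (weight q b + (k + Vec.sum a))) ℤ.- int (k * Vec.sum q + F)
    ≡⟨ x+y-x≡y (int (k * Vec.sum q + F)) (int (weight q b + (k + Vec.sum a))) ⟩
  int (weight q b + (k + Vec.sum a)) ∎
  where
  open ≡-Reasoning
  s = volume q
  F = floorSum s q b
  commute : ∀ x y z → (x ℤ.- y) ℤ.+ z ≡ (x ℤ.+ z) ℤ.- y
  commute = solve-∀ℤ
  regroup : ∀ a w f k x → a + ((w + f) + k * suc x) ≡ (k * x + f) + (w + (k + a))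
  regroup = solve-∀

radix-injective : ∀ s .{{_ : NonZero s}} {b b′ k k′} → b < s → b′ < s → b + k * s ≡ b′ + k′ * s → b ≡ b′ × k ≡ k′
radix-injective s {b} {b′} {k} {k′} b<s b′<s eq with b≡b′
  where
  b≡b′ : b ≡ b′
  b≡b′ = begin
    b                   ≡⟨ m<n⇒m%n≡m b<s ⟨
    b % s               ≡⟨ [m+kn]%n≡m%n b k s ⟨
    (b + k * s) % s     ≡⟨ cong (_% s) eq ⟩
    (b′ + k′ * s) % s   ≡⟨ [m+kn]%n≡m%n b′ k′ s ⟩
    b′ % s              ≡⟨ m<n⇒m%n≡m b′<s ⟩
    b′                  ∎
    where open ≡-Reasoning
... | refl = refl , *-cancelʳ-≡ k k′ s (+-cancelˡ-≡ b _ _ eq)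

decode : ∀ {n} → Vec ℕ n → ℕ × Vec ℕ (suc n) → Vec ℤ n
decode q (b , k ∷ a) = point (volume q) q b k a

dilate-enumerates : ∀ {n} (q : Vec ℕ n) t →
  Enumerates (List.map (decode q) (weightedCompositions (suc n) (weight q) t (volume q))) (InDilate n q t)
dilate-enumerates {n} q t = enumerates-map (decode q) (weightedCompositions-enumerates (suc n) (weight q) t s)
  (λ {x} {y} → injective x y) (λ {x} → sound x)
  (λ p p∈ → complete p (InDilate⇒InDilateℤ n q t p p∈))
  where
  s = volume q
  Index : ℕ × Vec ℕ (suc n) → Set
  Index (b , v) = b < s × weight q b + Vec.sum v ≡ t

  injective : ∀ x y → Index x → Index y → decode q x ≡ decode q y → x ≡ y
  -- Both indices have level t, so the common point fixes m = t - Σ pᵢ; division by Q recovers b and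
  -- k, and then the slacks are determined.
  injective (b , k ∷ a) (b′ , k′ ∷ a′) (b<s , eq) (b′<s , eq′) p≡p′ with
    radix-injective s {k = k} {k′} b<s b′<s (ℤ.+-injective (∙-cancelˡ (sumℤ (point s q b k a)) _ _ (begin
      sumℤ (point s q b k a) ℤ.+ int (b + k * s)        ≡⟨ trans (point-level q b k a) (cong int (trans eq (sym eq′))) ⟩
      int (weight q b′ + (k′ + Vec.sum a′))             ≡⟨ point-level q b′ k′ a′ ⟨
      sumℤ (point s q b′ k′ a′) ℤ.+ int (b′ + k′ * s)   ≡⟨ cong (λ p → sumℤ p ℤ.+ int (b′ + k′ * s)) p≡p′ ⟨
      sumℤ (point s q b k a) ℤ.+ int (b′ + k′ * s)      ∎)))
    where open ≡-Reasoning
  ... | refl , refl = cong (λ v → b , k ∷ v) (point-injective s q b k p≡p′)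

  sound : ∀ x → Index x → InDilate n q t (decode q x)
  sound (b , k ∷ a) (b<s , eq) = InDilateℤ⇒InDilate n q t (point s q b k a)
    (b + k * s , trans (point-level q b k a) (cong int eq) , point-nonNeg s q b k a)

  complete : ∀ p → InDilateℤ n q t p → ∃ λ x → Index x × p ≡ decode q x
  complete p (m , sum≡ , 0≤) with point-surjective s q (m % s) (m / s) p
      (subst (λ m → ∀ i → int 0 ℤ.≤ lookup p i ℤ.* int s ℤ.+ int (m * lookup q i)) (m≡m%n+[m/n]*n m s) 0≤)
  ... | a , refl = (m % s , m / s ∷ a) , (m%n<n m s , ℤ.+-injective (begin
      int (weight q (m % s) + (m / s + Vec.sum a))                     ≡⟨ point-level q (m % s) (m / s) a ⟨
      sumℤ (point s q (m % s) (m / s) a) ℤ.+ int (m % s + m / s * s)   ≡⟨ cong (λ m′ → sumℤ (point s q (m % s) (m / s) a) ℤ.+ int m′) (m≡m%n+[m/n]*n m s) ⟨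
      sumℤ (point s q (m % s) (m / s) a) ℤ.+ int m                     ≡⟨ sum≡ ⟩
      int t                                                            ∎)) , refl
    where open ≡-Reasoning

-- h*(Δ_(1,q)) = Σ_{b<Q} z^{w(b)}, with k allowed to be any integer.
hstarCoefficient : ∀ {n} → Vec ℕ n → ℤ → ℕ
hstarCoefficient q k = Σ< (volume q) (λ b → δ (k ℤ.- int (weight q b)))

-- Each b contributes z^w(b) / (1-z)^(n+1) to the Ehrhart series. The n + 1 partial sums commute
-- with the sum over b, and `hstar n L`, which unfolds to `altSum (suc n) L`, removes them.
hstar-formula : ∀ n (q : Vec ℕ n) L → (∀ t → IsLatticeCount n q t (L t)) →
  ∀ k → hstar n L k ≡ int (hstarCoefficient q (int k))
hstar-formula n q L counts = altSum-prefix^ (suc n) L (hstarCoefficient q ∘ int) λ t → begin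
  L t
    ≡⟨ (let ps , ps! , len , ps⇔ = counts t in
        trans (sym len) (enumerates-length (ps! , ps⇔) (dilate-enumerates q t))) ⟩
  length (List.map (decode q) (weightedCompositions (suc n) (weight q) t (volume q)))
    ≡⟨ length-map (decode q) (weightedCompositions (suc n) (weight q) t (volume q)) ⟩
  length (weightedCompositions (suc n) (weight q) t (volume q))
    ≡⟨ weightedCompositions-length (suc n) (weight q) t (volume q) ⟩
  Σ< (volume q) (λ b → prefix^ (suc n) (λ k → δ (int k ℤ.- int (weight q b))) t)
    ≡⟨ prefix^-Σ< (suc n) (volume q) (λ b k → δ (int k ℤ.- int (weight q b))) t ⟩
  prefix^ (suc n) (hstarCoefficient q ∘ int) t ∎
  where open ≡-Reasoning

-- Symmetric unimodal sequences

-- f is the coefficient sequence of a Laurent polynomial that is symmetric about d/2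
-- and nondecreasing up to there; the indices i and j = i + n of `monotone` satisfy i + j ≤ d.
record SymmetricUnimodal (d : ℕ) (f : ℤ → ℕ) : Set where
  field
    symmetric : ∀ i j → i ℤ.+ j ≡ int d → f i ≡ f j
    monotone  : ∀ i n n′ → i ℤ.+ (i ℤ.+ int n) ℤ.+ int n′ ≡ int d → f i ≤ f (i ℤ.+ int n)

open SymmetricUnimodal

-- Raising i with i + n fixed lowers both the gap n and the slack n′ by one. The induction ends at
-- gap 0, or at slack 0, where the two indices are mirror images.
monotone-from-step : ∀ {d} {f : ℤ → ℕ} → (∀ i j → i ℤ.+ j ≡ int d → f i ≡ f j) →
  (∀ i n → i ℤ.+ (i ℤ.+ int 1) ℤ.+ int n ≡ int d → f i ≤ f (i ℤ.+ int 1)) → SymmetricUnimodal d f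
monotone-from-step {d} {f} symm step = record { symmetric = symm ; monotone = mono }
  where
  mono : ∀ i n n′ → i ℤ.+ (i ℤ.+ int n) ℤ.+ int n′ ≡ int d → f i ≤ f (i ℤ.+ int n)
  mono i zero    n′       eq = ≤-reflexive (cong f (sym (ℤ.+-identityʳ i)))
  mono i (suc n) zero     eq = ≤-reflexive (symm i _ (trans (sym (ℤ.+-identityʳ _)) eq))
  mono i (suc n) (suc n′) eq = begin
    f i                              ≤⟨ step i (n + suc n′) (trans (regroup₁ i (int n) (int n′)) eq) ⟩
    f (i ℤ.+ int 1)                  ≤⟨ mono (i ℤ.+ int 1) n n′ (trans (regroup₂ i (int n) (int n′)) eq) ⟩
    f (i ℤ.+ int 1 ℤ.+ int n)        ≡⟨ cong f (ℤ.+-assoc i (int 1) (int n)) ⟩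
    f (i ℤ.+ int (suc n))            ∎
    where
    open ≤-Reasoning
    regroup₁ : ∀ i n n′ → i ℤ.+ (i ℤ.+ int 1) ℤ.+ (n ℤ.+ (int 1 ℤ.+ n′)) ≡ i ℤ.+ (i ℤ.+ (int 1 ℤ.+ n)) ℤ.+ (int 1 ℤ.+ n′)
    regroup₁ = solve-∀ℤ
    regroup₂ : ∀ i n n′ → i ℤ.+ int 1 ℤ.+ (i ℤ.+ int 1 ℤ.+ n) ℤ.+ n′ ≡ i ℤ.+ (i ℤ.+ (int 1 ℤ.+ n)) ℤ.+ (int 1 ℤ.+ n′)
    regroup₂ = solve-∀ℤ

symmetricUnimodal-resp : ∀ {d f g} → (∀ k → f k ≡ g k) → SymmetricUnimodal d f → SymmetricUnimodal d g
symmetricUnimodal-resp f≗g su = record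
  { symmetric = λ i j eq → trans (sym (f≗g i)) (trans (symmetric su i j eq) (f≗g j))
  ; monotone  = λ i n n′ eq → subst₂ _≤_ (f≗g i) (f≗g (i ℤ.+ int n)) (monotone su i n n′ eq)
  }

δ-symmetricUnimodal : SymmetricUnimodal 0 δ
δ-symmetricUnimodal = monotone-from-step symm step
  where
  symm : ∀ i j → i ℤ.+ j ≡ int 0 → δ i ≡ δ j
  symm i j eq with i ℤ.≟ int 0
  ... | yes refl = sym (δ-one (trans (sym (ℤ.+-identityˡ j)) eq))
  ... | no i≢0 = trans (δ-zero i i≢0) (sym (δ-zero j λ { refl → i≢0 (trans (sym (ℤ.+-identityʳ i)) eq) }))
  step : ∀ i n → i ℤ.+ (i ℤ.+ int 1) ℤ.+ int n ≡ int 0 → δ i ≤ δ (i ℤ.+ int 1)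
  -- `δ` drops only from 0 to 1, where the premise would read 1 + n = 0.
  step (int zero)    n ()
  step (int (suc _)) n eq = z≤n
  step -[1+ _ ]      n eq = z≤n

+-symmetricUnimodal : ∀ {d f g} → SymmetricUnimodal d f → SymmetricUnimodal d g →
  SymmetricUnimodal d (λ k → f k + g k)
+-symmetricUnimodal f-su g-su = record
  { symmetric = λ i j eq → cong₂ _+_ (symmetric f-su i j eq) (symmetric g-su i j eq)
  ; monotone  = λ i n n′ eq → +-mono-≤ (monotone f-su i n n′ eq) (monotone g-su i n n′ eq)
  }

*-symmetricUnimodal : ∀ {d f} c → SymmetricUnimodal d f → SymmetricUnimodal d (λ k → c * f k)
*-symmetricUnimodal c su = record
  { symmetric = λ i j eq → cong (c ℕ.*_) (symmetric su i j eq)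
  ; monotone  = λ i n n′ eq → *-monoʳ-≤ c (monotone su i n n′ eq)
  }

-- The parameter is twice the centre, so moving the centre by one adds 2.
shift-symmetricUnimodal : ∀ {d f} → SymmetricUnimodal d f → SymmetricUnimodal (2 + d) (λ k → f (k ℤ.- int 1))
shift-symmetricUnimodal {d} {f} su = monotone-from-step symm step
  where
  regroup₁ : ∀ i j → (i ℤ.- int 1) ℤ.+ (j ℤ.- int 1) ≡ (i ℤ.+ j) ℤ.- int 2
  regroup₁ = solve-∀ℤ
  regroup₂ : ∀ i n → (i ℤ.- int 1) ℤ.+ ((i ℤ.- int 1) ℤ.+ int 1) ℤ.+ n ≡ (i ℤ.+ (i ℤ.+ int 1) ℤ.+ n) ℤ.- int 2
  regroup₂ = solve-∀ℤ
  exchange : ∀ i → (i ℤ.- int 1) ℤ.+ int 1 ≡ (i ℤ.+ int 1) ℤ.- int 1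
  exchange = solve-∀ℤ
  symm : ∀ i j → i ℤ.+ j ≡ int (2 + d) → f (i ℤ.- int 1) ≡ f (j ℤ.- int 1)
  symm i j eq = symmetric su _ _ (trans (regroup₁ i j) (cong (ℤ._- int 2) eq))
  step : ∀ i n → i ℤ.+ (i ℤ.+ int 1) ℤ.+ int n ≡ int (2 + d) → f (i ℤ.- int 1) ≤ f ((i ℤ.+ int 1) ℤ.- int 1)
  step i n eq = subst (λ j → f (i ℤ.- int 1) ≤ f j) (exchange i)
    (monotone su (i ℤ.- int 1) 1 n (trans (regroup₂ i (int n)) (cong (ℤ._- int 2) eq)))

-- Multiplication by 1 + z + ⋯ + z^m.
box : ℕ → (ℤ → ℕ) → ℤ → ℕ
box m f k = Σ< (suc m) (λ i → f (k ℤ.- int i))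

box-symmetricUnimodal : ∀ {d f} m → SymmetricUnimodal d f → SymmetricUnimodal (m + d) (box m f)
box-symmetricUnimodal {d} {f} m su = monotone-from-step symm step
  where
  symm : ∀ i j → i ℤ.+ j ≡ int (m + d) → box m f i ≡ box m f j
  -- After reversal the paired indices i - (m - l) and j - l sum to d.
  symm i j eq = trans (Σ<-reverse m _) (Σ<-cong (suc m) λ { l (s≤s l≤m) →
    symmetric su _ _ (begin
      (i ℤ.- int (m ∸ l)) ℤ.+ (j ℤ.- int l)       ≡⟨ regroup i j (int (m ∸ l)) (int l) ⟩
      (i ℤ.+ j) ℤ.- int (m ∸ l + l)               ≡⟨ cong₂ (λ x y → x ℤ.- int y) eq (m∸n+n≡m l≤m) ⟩
      (int m ℤ.+ int d) ℤ.- int m                 ≡⟨ x+y-x≡y (int m) (int d) ⟩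
      int d                                       ∎) })
    where
    open ≡-Reasoning
    regroup : ∀ i j x y → (i ℤ.- x) ℤ.+ (j ℤ.- y) ≡ (i ℤ.+ j) ℤ.- (x ℤ.+ y)
    regroup = solve-∀ℤ
  -- The increment of box m f at i is f (i + 1) − f (i − m).
  step : ∀ i n → i ℤ.+ (i ℤ.+ int 1) ℤ.+ int n ≡ int (m + d) → box m f i ≤ box m f (i ℤ.+ int 1)
  step i n eq = begin
    Σ< m (λ l → f (i ℤ.- int l)) + f (i ℤ.- int m)
      -- The indices i - m and i + 1 sum to 2 i + 1 - m ≤ d, so `monotone` applies across the gap m
      -- + 1.
      ≤⟨ +-monoʳ-≤ (Σ< m (λ l → f (i ℤ.- int l))) (monotone su (i ℤ.- int m) (suc m) n
           (trans (regroup i (int m) (int n)) (trans (cong (ℤ._- int m) eq) (x+y-x≡y (int m) (int d))))) ⟩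
    Σ< m (λ l → f (i ℤ.- int l)) + f (i ℤ.- int m ℤ.+ int (suc m))
      ≡⟨ +-comm (Σ< m (λ l → f (i ℤ.- int l))) _ ⟩
    f (i ℤ.- int m ℤ.+ int (suc m)) + Σ< m (λ l → f (i ℤ.- int l))
      ≡⟨ cong₂ _+_ (cong f (end i (int m))) (Σ<-cong m λ l _ → cong f (exchange i (int l))) ⟩
    f (i ℤ.+ int 1 ℤ.- int 0) + Σ< m (λ l → f (i ℤ.+ int 1 ℤ.- int (suc l)))
      ≡⟨ Σ<-front m (λ l → f (i ℤ.+ int 1 ℤ.- int l)) ⟨
    box m f (i ℤ.+ int 1) ∎
    where
    open ≤-Reasoning
    regroup : ∀ i m n → (i ℤ.- m) ℤ.+ ((i ℤ.- m) ℤ.+ (int 1 ℤ.+ m)) ℤ.+ n ≡ (i ℤ.+ (i ℤ.+ int 1) ℤ.+ n) ℤ.- m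
    regroup = solve-∀ℤ
    end : ∀ i m → i ℤ.- m ℤ.+ (int 1 ℤ.+ m) ≡ i ℤ.+ int 1 ℤ.- int 0
    end = solve-∀ℤ
    exchange : ∀ i l → i ℤ.- l ≡ i ℤ.+ int 1 ℤ.- (int 1 ℤ.+ l)
    exchange = solve-∀ℤ

symmetricUnimodal⇒unimodal : ∀ {d f} {h : ℕ → ℤ} → SymmetricUnimodal d f → (∀ k → h k ≡ int (f (int k))) → Unimodal d h
symmetricUnimodal⇒unimodal {d} {f} {h} su h≡f = ⌊ d /2⌋ , ⌊n/2⌋≤n d , ascending , descending
  where
  ascending : ∀ i → i < ⌊ d /2⌋ → h i ℤ.≤ h (suc i)
  ascending i i<t = subst₂ ℤ._≤_ (sym (h≡f i)) (trans (cong (int ∘ f ∘ int) (+-comm i 1)) (sym (h≡f (suc i))))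
    (ℤ.+≤+ (monotone su (int i) 1 (d ∸ (i + (i + 1))) (cong int (m+[n∸m]≡n below))))
    where
    below : i + (i + 1) ≤ d
    below = begin
      i + (i + 1)             ≤⟨ +-mono-≤ (<⇒≤ i<t) (≤-trans (≤-reflexive (+-comm i 1)) i<t) ⟩
      ⌊ d /2⌋ + ⌊ d /2⌋       ≤⟨ +-monoʳ-≤ ⌊ d /2⌋ (⌊n/2⌋≤⌈n/2⌉ d) ⟩
      ⌊ d /2⌋ + ⌈ d /2⌉       ≡⟨ ⌊n/2⌋+⌈n/2⌉≡n d ⟩
      d                       ∎
      where open ≤-Reasoning
  -- By symmetry h (i + 1) ≤ h i reads h (d − i − 1) ≤ h (d − i), written below with c = d − i − 1.
  descending : ∀ i → ⌊ d /2⌋ ≤ i → suc i ≤ d → h (suc i) ℤ.≤ h i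
  descending i t≤i i<d = subst₂ ℤ._≤_ (sym (h≡f (suc i))) (sym (h≡f i)) (ℤ.+≤+ (begin
      f (int (suc i))     ≡⟨ symmetric su (int (suc i)) (int c) (cong int c-eq) ⟩
      f (int c)           ≤⟨ monotone su (int c) 1 (d ∸ (c + (c + 1))) (cong int (m+[n∸m]≡n below)) ⟩
      f (int (c + 1))     ≡⟨ symmetric su (int (c + 1)) (int i) (cong int (trans (rotate c i) c-eq)) ⟩
      f (int i)           ∎))
    where
    open ≤-Reasoning
    c = d ∸ suc i
    c-eq : suc i + c ≡ d
    c-eq = m+[n∸m]≡n i<d
    rotate : ∀ c i → c + 1 + i ≡ suc i + c
    rotate = solve-∀
    c≤i : c ≤ i
    c≤i = +-cancelˡ-≤ (suc i) c i (begin
      suc i + c                     ≡⟨ c-eq ⟩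
      d                             ≡⟨ ⌊n/2⌋+⌈n/2⌉≡n d ⟨
      ⌊ d /2⌋ + ⌈ d /2⌉             ≤⟨ +-monoʳ-≤ ⌊ d /2⌋ (⌊n/2⌋-mono (n≤1+n (suc d))) ⟩
      ⌊ d /2⌋ + suc ⌊ d /2⌋         ≤⟨ +-mono-≤ t≤i (s≤s t≤i) ⟩
      i + suc i                     ≡⟨ +-comm i (suc i) ⟩
      suc i + i                     ∎)
    below : c + (c + 1) ≤ d
    below = begin
      c + (c + 1)     ≡⟨ +-assoc c c 1 ⟨
      c + c + 1       ≤⟨ +-monoˡ-≤ 1 (+-monoʳ-≤ c c≤i) ⟩
      c + i + 1       ≡⟨ rotate′ c i ⟩
      suc i + c       ≡⟨ c-eq ⟩
      d               ∎
      where
      rotate′ : ∀ c i → c + i + 1 ≡ suc i + c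
      rotate′ = solve-∀

hstar-unimodal : ∀ {n} (q : Vec ℕ n) → SymmetricUnimodal n (hstarCoefficient q) → HStarUnimodal n q
hstar-unimodal {n} q su L counts = symmetricUnimodal⇒unimodal su (hstar-formula n q L counts)

-- The three families

-- The last base-s digit plus the whole quotient, which is not expanded further.
digitSum : ∀ s .{{_ : NonZero s}} → ℕ → ℕ
digitSum s m = m % s + m / s

[u+v*s]/s≡v : ∀ s .{{_ : NonZero s}} u v → u < s → (u + v * s) / s ≡ v
[u+v*s]/s≡v s u v u<s =
  trans (+-distrib-/-∣ʳ u (divides-refl v)) (cong₂ _+_ (m<n⇒m/n≡0 u<s) (m*n/n≡m v s))

digitSum-radix : ∀ s .{{_ : NonZero s}} u v → u < s → digitSum s (u + v * s) ≡ u + v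
digitSum-radix s u v u<s =
  cong₂ _+_ (trans ([m+kn]%n≡m%n u v s) (m<n⇒m%n≡m u<s)) ([u+v*s]/s≡v s u v u<s)

-- A window of s = y + 1 consecutive arguments of the digit sum, starting at j + k s:
-- moving it one step replaces the value k + j by k + j + 1.
digitSum-window : ∀ y (φ : ℕ → ℕ) k j → j ≤ y →
  Σ< (suc y) (λ u → φ (digitSum (suc y) (u + (j + k * suc y)))) ≡ φ (k + j) + Σ< y (λ i → φ (suc (k + i)))
digitSum-window y φ k zero _ = begin
  Σ< (suc y) (λ u → φ (digitSum (suc y) (u + k * suc y)))
    ≡⟨ Σ<-cong (suc y) (λ u u<s → cong φ (trans (digitSum-radix (suc y) u k u<s) (+-comm u k))) ⟩
  Σ< (suc y) (λ u → φ (k + u))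
    ≡⟨ Σ<-front y (λ u → φ (k + u)) ⟩
  φ (k + 0) + Σ< y (λ i → φ (k + suc i))
    ≡⟨ cong (φ (k + 0) ℕ.+_) (Σ<-cong y λ i _ → cong φ (+-suc k i)) ⟩
  φ (k + 0) + Σ< y (λ i → φ (suc (k + i))) ∎
  where open ≡-Reasoning
digitSum-window y φ k (suc j) j<y = +-cancelˡ-≡ (φ (k + j)) _ _ (begin
  -- With the value that left the window restored, there are s + 1 consecutive terms, the first s of
  -- which form the previous window.
  φ (k + j) + Σ< s (λ u → ψ (u + (suc j + k * s)))
    ≡⟨ cong₂ _+_ (cong φ (trans (+-comm k j) (sym (digitSum-radix s j k (m<n⇒m<1+n j<y)))))
                 (Σ<-cong s λ u _ → cong ψ (+-suc u (j + k * s))) ⟩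
  ψ (j + k * s) + Σ< s (λ u → ψ (suc u + (j + k * s)))
    ≡⟨ Σ<-front s (λ u → ψ (u + (j + k * s))) ⟨
  Σ< s (λ u → ψ (u + (j + k * s))) + ψ (s + (j + k * s))
    ≡⟨ cong₂ _+_ (digitSum-window y φ k j (<⇒≤ j<y)) (cong φ next) ⟩
  φ (k + j) + Σ< y (λ i → φ (suc (k + i))) + φ (k + suc j)
    ≡⟨ rotate (φ (k + j)) _ _ ⟩
  φ (k + j) + (φ (k + suc j) + Σ< y (λ i → φ (suc (k + i)))) ∎)
  where
  open ≡-Reasoning
  s = suc y
  ψ : ℕ → ℕ
  ψ m = φ (digitSum s m)
  rotate : ∀ a b c → a + b + c ≡ a + (c + b)
  rotate = solve-∀
  regroup : ∀ s j k → s + (j + k * s) ≡ j + suc k * s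
  regroup = solve-∀
  next : digitSum s (s + (j + k * s)) ≡ k + suc j
  next = trans (cong (digitSum s) (regroup s j k)) (trans (digitSum-radix s j (suc k) (m<n⇒m<1+n j<y))
    (trans (+-suc j k) (trans (cong suc (+-comm j k)) (sym (+-suc k j)))))

-- For fixed v the sum over u is a window. The range of v consists of x blocks of s = y + 1 starting
-- points and the single point x s. In block k the varying values k + j give row k of the first
-- double sum, and the common values k + 1, ..., k + y occur s times, which explains the factor
-- `suc y`. The aligned window at x s supplies the missing row k = x.
digitSum-sum : ∀ x y (φ : ℕ → ℕ) →
  Σ< (suc y) (λ u → Σ< (suc (x * suc y)) (λ v → φ (digitSum (suc y) (u + v)))) ≡
  Σ< (suc x) (λ k → Σ< (suc y) (λ j → φ (k + j))) + suc y * Σ< x (λ k → Σ< y (λ i → φ (suc (k + i))))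
digitSum-sum x y φ = begin
  Σ< s (λ u → Σ< (suc (x * s)) (λ v → φ (digitSum s (u + v))))
    ≡⟨ Σ<-swap s (suc (x * s)) _ ⟩
  Σ< (x * s) window + window (x * s)
    ≡⟨ cong₂ _+_ (Σ<-radix x s window) last ⟩
  Σ< x (λ k → Σ< s (λ j → window (j + k * s))) + Σ< s (λ j → φ (x + j))
    ≡⟨ cong (ℕ._+ Σ< s (λ j → φ (x + j))) (Σ<-cong x λ k _ → block k) ⟩
  Σ< x (λ k → Σ< s (λ j → φ (k + j)) + s * tail k) + Σ< s (λ j → φ (x + j))
    ≡⟨ cong (ℕ._+ Σ< s (λ j → φ (x + j))) (trans (Σ<-distrib-+ x _ _) (cong (Σ< x (λ k → Σ< s (λ j → φ (k + j))) ℕ.+_) (Σ<-*ˡ x s tail))) ⟩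
  Σ< x (λ k → Σ< s (λ j → φ (k + j))) + s * Σ< x tail + Σ< s (λ j → φ (x + j))
    ≡⟨ exchange (Σ< x (λ k → Σ< s (λ j → φ (k + j)))) (s * Σ< x tail) (Σ< s (λ j → φ (x + j))) ⟩
  Σ< (suc x) (λ k → Σ< s (λ j → φ (k + j))) + s * Σ< x tail ∎
  where
  open ≡-Reasoning
  s = suc y
  window : ℕ → ℕ
  window v = Σ< s (λ u → φ (digitSum s (u + v)))
  tail : ℕ → ℕ
  tail k = Σ< y (λ i → φ (suc (k + i)))
  exchange : ∀ a b c → a + b + c ≡ a + c + b
  exchange = solve-∀
  last : window (x * s) ≡ Σ< s (λ j → φ (x + j))
  last = Σ<-cong s λ u u<s → cong φ (trans (digitSum-radix s u x u<s) (+-comm u x))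
  block : ∀ k → Σ< s (λ j → window (j + k * s)) ≡ Σ< s (λ j → φ (k + j)) + s * tail k
  block k = begin
    Σ< s (λ j → window (j + k * s))                     ≡⟨ Σ<-cong s (λ { j (s≤s j≤y) → digitSum-window y φ k j j≤y }) ⟩
    Σ< s (λ j → φ (k + j) + tail k)                     ≡⟨ Σ<-distrib-+ s (λ j → φ (k + j)) (λ _ → tail k) ⟩
    Σ< s (λ j → φ (k + j)) + Σ< s (λ _ → tail k)        ≡⟨ cong (Σ< s (λ j → φ (k + j)) ℕ.+_) (Σ<-const s (tail k)) ⟩
    Σ< s (λ j → φ (k + j)) + s * tail k                 ∎

minus-sum : ∀ k i j → k ℤ.- int (i + j) ≡ k ℤ.- int i ℤ.- int j
minus-sum k i j = regroup k (int i) (int j)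
  where
  regroup : ∀ k i j → k ℤ.- (i ℤ.+ j) ≡ k ℤ.- i ℤ.- j
  regroup = solve-∀ℤ

digitSumCount : ℕ → ℕ → ℤ → ℕ
digitSumCount x y k =
  Σ< (suc y) (λ u → Σ< (suc (x * suc y)) (λ v → δ (k ℤ.- int (digitSum (suc y) (u + v)))))

box-box : ∀ x y k → Σ< (suc x) (λ i → Σ< (suc y) (λ j → δ (k ℤ.- int (i + j)))) ≡ box x (box y δ) k
box-box x y k = Σ<-cong (suc x) λ i _ → Σ<-cong (suc y) λ j _ → cong δ (minus-sum k i j)

-- `box m` multiplies by [m + 1], so the factors [x] and [y] of the second summand are boxes only
-- for positive lengths; hence the successors.
digitSumCount-box : ∀ x y k → digitSumCount (suc x) (suc y) k ≡
  box (suc x) (box (suc y) δ) k + (2 + y) * box x (box y δ) (k ℤ.- int 1)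
digitSumCount-box x y k = trans (digitSum-sum (suc x) (suc y) (λ m → δ (k ℤ.- int m)))
  (cong₂ (λ a b → a + (2 + y) * b) (box-box (suc x) (suc y) k)
    (trans (Σ<-cong (suc x) λ i _ → Σ<-cong (suc y) λ j _ → cong δ (minus-sum k 1 (i + j)))
           (box-box x y (k ℤ.- int 1))))

digitSumCount-symmetricUnimodal : ∀ x y → SymmetricUnimodal (suc x + suc y) (digitSumCount (suc x) (suc y))
digitSumCount-symmetricUnimodal x y = symmetricUnimodal-resp (λ k → sym (digitSumCount-box x y k))
  (+-symmetricUnimodal
    (subst (λ d → SymmetricUnimodal d (box (suc x) (box (suc y) δ))) (degree₁ x y)
      (box-symmetricUnimodal (suc x) (box-symmetricUnimodal (suc y) δ-symmetricUnimodal)))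
    (*-symmetricUnimodal (2 + y)
      (subst (λ d → SymmetricUnimodal d (λ k → box x (box y δ) (k ℤ.- int 1))) (degree₂ x y)
        (shift-symmetricUnimodal (box-symmetricUnimodal x (box-symmetricUnimodal y δ-symmetricUnimodal))))))
  where
  degree₁ : ∀ x y → suc x + (suc y + 0) ≡ suc x + suc y
  degree₁ = solve-∀
  degree₂ : ∀ x y → 2 + (x + (y + 0)) ≡ suc x + suc y
  degree₂ = solve-∀

-- Volume and weight for three repeated entries

sum-replicate : ∀ x r → Vec.sum (replicate x r) ≡ x * r
sum-replicate zero    r = refl
sum-replicate (suc x) r = cong (r ℕ.+_) (sum-replicate x r)

floorSum-replicate : ∀ s .{{_ : NonZero s}} x r b → floorSum s (replicate x r) b ≡ x * (b * r / s)
floorSum-replicate s zero    r b = refl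
floorSum-replicate s (suc x) r b = cong (b * r / s ℕ.+_) (floorSum-replicate s x r b)

floorSum-++ : ∀ {m n} s .{{_ : NonZero s}} (q : Vec ℕ m) (q′ : Vec ℕ n) b →
  floorSum s (q Vec.++ q′) b ≡ floorSum s q b + floorSum s q′ b
floorSum-++ s []      q′ b = refl
floorSum-++ s (r ∷ q) q′ b = trans (cong (b * r / s ℕ.+_) (floorSum-++ s q q′ b)) (sym (+-assoc (b * r / s) _ _))

volume-repVec : ∀ r₁ r₂ r₃ x₁ x₂ x₃ →
  volume (repVec r₁ r₂ r₃ x₁ x₂ x₃) ≡ suc (x₁ * r₁ + (x₂ * r₂ + x₃ * r₃))
volume-repVec r₁ r₂ r₃ x₁ x₂ x₃ = cong suc (trans (sum-++ (replicate x₁ r₁))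
  (cong₂ _+_ (sum-replicate x₁ r₁) (trans (sum-++ (replicate x₂ r₂))
    (cong₂ _+_ (sum-replicate x₂ r₂) (sum-replicate x₃ r₃)))))

-- Cancelling r turns b r / s into b / D, and u is the remainder.
floor-unique : ∀ {s r b} .{{_ : NonZero s}} D u v → s ≡ D * r → b ≡ u + v * D → u < D → b * r / s ≡ v
floor-unique {r = r} D u v refl refl u<D = trans (m*n/o*n≡m/o (u + v * D) r D) ([u+v*s]/s≡v D u v u<D)
  where instance _ = >-nonZero (≤-<-trans z≤n u<D)

-- The last premise states the weight additively, so that each family only has to verify an identity
-- without subtraction.
weight-repVec : ∀ r₁ r₂ r₃ x₁ x₂ x₃ {b g₁ g₂ g₃} w → (let s = volume (repVec r₁ r₂ r₃ x₁ x₂ x₃)) →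
  b * r₁ / s ≡ g₁ → b * r₂ / s ≡ g₂ → b * r₃ / s ≡ g₃ →
  b ≡ w + (x₁ * g₁ + (x₂ * g₂ + x₃ * g₃)) →
  weight (repVec r₁ r₂ r₃ x₁ x₂ x₃) b ≡ w
weight-repVec r₁ r₂ r₃ x₁ x₂ x₃ {b} {g₁} {g₂} {g₃} w eq₁ eq₂ eq₃ b≡ = begin
  b ∸ floorSum s (repVec r₁ r₂ r₃ x₁ x₂ x₃) b
    ≡⟨ cong (b ∸_) floors ⟩
  b ∸ (x₁ * g₁ + (x₂ * g₂ + x₃ * g₃))
    ≡⟨ cong (_∸ (x₁ * g₁ + (x₂ * g₂ + x₃ * g₃))) b≡ ⟩
  w + (x₁ * g₁ + (x₂ * g₂ + x₃ * g₃)) ∸ (x₁ * g₁ + (x₂ * g₂ + x₃ * g₃))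
    ≡⟨ m+n∸n≡m w (x₁ * g₁ + (x₂ * g₂ + x₃ * g₃)) ⟩
  w ∎
  where
  open ≡-Reasoning
  s = volume (repVec r₁ r₂ r₃ x₁ x₂ x₃)
  floors : floorSum s (repVec r₁ r₂ r₃ x₁ x₂ x₃) b ≡ x₁ * g₁ + (x₂ * g₂ + x₃ * g₃)
  floors = trans (floorSum-++ s (replicate x₁ r₁) _ b)
    (cong₂ _+_ (trans (floorSum-replicate s x₁ r₁ b) (cong (x₁ ℕ.*_) eq₁))
      (trans (floorSum-++ s (replicate x₂ r₂) _ b)
        (cong₂ _+_ (trans (floorSum-replicate s x₂ r₂ b) (cong (x₂ ℕ.*_) eq₂))
                   (trans (floorSum-replicate s x₃ r₃ b) (cong (x₃ ℕ.*_) eq₃)))))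

radix-< : ∀ {m n i j} → j < n → i < m → j + i * n < m * n
radix-< {m} {n} {i} {j} j<n i<m = <-≤-trans (+-monoˡ-< (i * n) j<n) (*-monoˡ-≤ n i<m)

-- Family (i): three independent digits

module CaseI (x₁ x₂ x₃ : ℕ) where
  q = repVec 1 (1 + x₁) ((1 + x₁) * (1 + x₂)) x₁ x₂ x₃

  volume-q : volume q ≡ (1 + x₁) * ((1 + x₂) * (1 + x₃))
  volume-q = trans (volume-repVec 1 (1 + x₁) ((1 + x₁) * (1 + x₂)) x₁ x₂ x₃) (factor x₁ x₂ x₃)
    where
    factor : ∀ x₁ x₂ x₃ → suc (x₁ * 1 + (x₂ * (1 + x₁) + x₃ * ((1 + x₁) * (1 + x₂)))) ≡ (1 + x₁) * ((1 + x₂) * (1 + x₃))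
    factor = solve-∀

  -- The values Q / rᵢ are Q, (1 + x₂)(1 + x₃) and 1 + x₃, so the floors 0, f and e + f (1 + x₂) are
  -- the leading parts of the expansion of b.
  weight-q : ∀ f e c → f < 1 + x₁ → e < 1 + x₂ → c < 1 + x₃ →
    weight q ((c + e * (1 + x₃)) + f * ((1 + x₂) * (1 + x₃))) ≡ f + (e + c)
  weight-q f e c f< e< c< = weight-repVec 1 (1 + x₁) ((1 + x₁) * (1 + x₂)) x₁ x₂ x₃ (f + (e + c))
    (floor-unique (volume q) b 0 (sym (*-identityʳ (volume q))) (sym (+-identityʳ b))
      (subst (b <_) (sym volume-q) (radix-< (radix-< c< e<) f<)))
    (floor-unique ((1 + x₂) * (1 + x₃)) (c + e * (1 + x₃)) f (trans volume-q (*-comm (1 + x₁) _)) refl (radix-< c< e<))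
    (floor-unique (1 + x₃) c (e + f * (1 + x₂)) (trans volume-q (rotate (1 + x₁) (1 + x₂) (1 + x₃)))
      (regroup c e f (1 + x₂) (1 + x₃)) c<)
    (total c e f x₁ x₂ x₃)
    where
    b = (c + e * (1 + x₃)) + f * ((1 + x₂) * (1 + x₃))
    rotate : ∀ F E T → F * (E * T) ≡ T * (F * E)
    rotate = solve-∀
    regroup : ∀ c e f E T → (c + e * T) + f * (E * T) ≡ c + (e + f * E) * T
    regroup = solve-∀
    total : ∀ c e f x₁ x₂ x₃ → (c + e * (1 + x₃)) + f * ((1 + x₂) * (1 + x₃)) ≡
      (f + (e + c)) + (x₁ * 0 + (x₂ * f + x₃ * (e + f * (1 + x₂))))
    total = solve-∀

  hstarCoefficient-q : ∀ k → hstarCoefficient q k ≡ box x₁ (box x₂ (box x₃ δ)) k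
  hstarCoefficient-q k = begin
    Σ< (volume q) g
      ≡⟨ cong (λ s → Σ< s g) volume-q ⟩
    Σ< ((1 + x₁) * ((1 + x₂) * (1 + x₃))) g
      ≡⟨ Σ<-radix (1 + x₁) ((1 + x₂) * (1 + x₃)) g ⟩
    Σ< (1 + x₁) (λ f → Σ< ((1 + x₂) * (1 + x₃)) (λ a → g (a + f * ((1 + x₂) * (1 + x₃)))))
      ≡⟨ Σ<-cong (1 + x₁) (λ f f< → trans (Σ<-radix (1 + x₂) (1 + x₃) _)
           (Σ<-cong (1 + x₂) λ e e< → Σ<-cong (1 + x₃) λ c c< → cong δ
             (trans (cong (λ w → k ℤ.- int w) (weight-q f e c f< e< c<))
               (trans (minus-sum k f (e + c)) (minus-sum (k ℤ.- int f) e c))))) ⟩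
    box x₁ (box x₂ (box x₃ δ)) k ∎
    where
    open ≡-Reasoning
    g : ℕ → ℕ
    g b = δ (k ℤ.- int (weight q b))

-- With B = 1 + x s, the two-digit number v + u B is u + v + x u s.
mixed-radix : ∀ x s .{{_ : NonZero s}} u v → v + u * (1 + x * s) ≡ (u + v) % s + ((u + v) / s + x * u) * s
mixed-radix x s u v = begin
  v + u * (1 + x * s)                                 ≡⟨ regroup x s u v ⟩
  (u + v) + x * u * s                                 ≡⟨ cong (ℕ._+ x * u * s) (m≡m%n+[m/n]*n (u + v) s) ⟩
  (u + v) % s + (u + v) / s * s + x * u * s           ≡⟨ collect ((u + v) % s) ((u + v) / s) (x * u) s ⟩
  (u + v) % s + ((u + v) / s + x * u) * s             ∎
  where
  open ≡-Reasoning
  regroup : ∀ x s u v → v + u * (1 + x * s) ≡ (u + v) + x * u * s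
  regroup = solve-∀
  collect : ∀ m g y s → m + g * s + y * s ≡ m + (g + y) * s
  collect = solve-∀

-- Family (ii): a free lowest digit

module CaseII (x₁ x₂ x₃ : ℕ) where
  S = 1 + x₂
  B = 1 + x₁ * S
  T = 1 + x₃
  q = repVec S B (B * S) x₁ x₂ x₃

  volume-q : volume q ≡ (S * B) * T
  volume-q = trans (volume-repVec S B (B * S) x₁ x₂ x₃) (factor x₁ x₂ x₃)
    where
    factor : ∀ x₁ x₂ x₃ → suc (x₁ * (1 + x₂) + (x₂ * (1 + x₁ * (1 + x₂)) + x₃ * ((1 + x₁ * (1 + x₂)) * (1 + x₂)))) ≡
      ((1 + x₂) * (1 + x₁ * (1 + x₂))) * (1 + x₃)
    factor = solve-∀

  -- The values Q / rᵢ are B T, S T and T. Division by T removes c; what is left, v + u B, is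
  -- divided by B directly and by S through `mixed-radix`.
  weight-q : ∀ c u v → c < T → u < S → v < B →
    weight q (c + (v + u * B) * T) ≡ c + digitSum S (u + v)
  weight-q c u v c< u< v< = weight-repVec S B (B * S) x₁ x₂ x₃ (c + digitSum S (u + v))
    (floor-unique (B * T) (c + v * T) u (trans volume-q (order₁ S B T)) (regroup₁ c v u B T) (radix-< c< v<))
    (floor-unique (S * T) (c + m * T) (g + x₁ * u) (trans volume-q (order₂ S B T))
      (trans (cong (λ a → c + a * T) (mixed-radix x₁ S u v)) (regroup₁ c m (g + x₁ * u) S T))
      (radix-< c< (m%n<n (u + v) S)))
    (floor-unique T c (v + u * B) (trans volume-q (order₃ S B T)) refl c<)
    (begin
      c + (v + u * B) * T                              ≡⟨ split c (v + u * B) x₃ ⟩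
      c + (v + u * B) + x₃ * (v + u * B)               ≡⟨ cong (λ a → c + a + x₃ * (v + u * B)) (mixed-radix x₁ S u v) ⟩
      c + (m + (g + x₁ * u) * S) + x₃ * (v + u * B)    ≡⟨ total c m g u x₁ x₂ (x₃ * (v + u * B)) ⟩
      (c + (m + g)) + (x₁ * u + (x₂ * (g + x₁ * u) + x₃ * (v + u * B))) ∎)
    where
    open ≡-Reasoning
    m = (u + v) % S
    g = (u + v) / S
    order₁ : ∀ S B T → S * B * T ≡ B * T * S
    order₁ = solve-∀
    order₂ : ∀ S B T → S * B * T ≡ S * T * B
    order₂ = solve-∀
    order₃ : ∀ S B T → S * B * T ≡ T * (B * S)
    order₃ = solve-∀
    regroup₁ : ∀ c v u B T → c + (v + u * B) * T ≡ c + v * T + u * (B * T)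
    regroup₁ = solve-∀
    split : ∀ c a x → c + a * (1 + x) ≡ c + a + x * a
    split = solve-∀
    total : ∀ c m g u x₁ x₂ z → c + (m + (g + x₁ * u) * (1 + x₂)) + z ≡
      (c + (m + g)) + (x₁ * u + (x₂ * (g + x₁ * u) + z))
    total = solve-∀

  hstarCoefficient-q : ∀ k → hstarCoefficient q k ≡ box x₃ (digitSumCount x₁ x₂) k
  hstarCoefficient-q k = begin
    Σ< (volume q) f
      ≡⟨ cong (λ s → Σ< s f) volume-q ⟩
    Σ< (S * B * T) f
      ≡⟨ Σ<-radix (S * B) T f ⟩
    Σ< (S * B) (λ a → Σ< T (λ c → f (c + a * T)))
      -- The lowest digit c carries the factor [x₃ + 1], which the target writes outermost.
      ≡⟨ Σ<-swap (S * B) T _ ⟩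
    Σ< T (λ c → Σ< (S * B) (λ a → f (c + a * T)))
      ≡⟨ Σ<-cong T (λ c c< → trans (Σ<-radix S B _)
           (Σ<-cong S λ u u< → Σ<-cong B λ v v< → cong δ
             (trans (cong (λ w → k ℤ.- int w) (weight-q c u v c< u< v<)) (minus-sum k c _)))) ⟩
    box x₃ (digitSumCount x₁ x₂) k ∎
    where
    open ≡-Reasoning
    f : ℕ → ℕ
    f b = δ (k ℤ.- int (weight q b))

-- Family (iv): a free highest digit

module CaseIV (x₁ x₂ x₃ : ℕ) where
  F = 1 + x₁
  S = 1 + x₃
  B = 1 + x₂ * S
  q = repVec 1 (F * S) (F * B) x₁ x₂ x₃

  volume-q : volume q ≡ F * (S * B)
  volume-q = trans (volume-repVec 1 (F * S) (F * B) x₁ x₂ x₃) (factor x₁ x₂ x₃)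
    where
    factor : ∀ x₁ x₂ x₃ → suc (x₁ * 1 + (x₂ * ((1 + x₁) * (1 + x₃)) + x₃ * ((1 + x₁) * (1 + x₂ * (1 + x₃))))) ≡
      (1 + x₁) * ((1 + x₃) * (1 + x₂ * (1 + x₃)))
    factor = solve-∀

  -- The values Q / rᵢ are Q, B and S. The top digit f enters b with the factor S B, divisible by
  -- both B and S, so `mixed-radix` is needed only for v + u B.
  weight-q : ∀ f u v → f < F → u < S → v < B →
    weight q ((v + u * B) + f * (S * B)) ≡ f + digitSum S (u + v)
  weight-q f u v f< u< v< = weight-repVec 1 (F * S) (F * B) x₁ x₂ x₃ (f + digitSum S (u + v))
    (floor-unique (volume q) b 0 (sym (*-identityʳ (volume q))) (sym (+-identityʳ b))
      (subst (b <_) (sym volume-q) (radix-< (radix-< v< u<) f<)))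
    (floor-unique B v (u + f * S) (trans volume-q (order₂ F S B)) (regroup₂ u v f S B) v<)
    (floor-unique S m (g + x₂ * u + f * B) (trans volume-q (order₃ F S B)) b≡ (m%n<n (u + v) S))
    (trans b≡ (total m g u f x₁ x₂ x₃))
    where
    open ≡-Reasoning
    b = (v + u * B) + f * (S * B)
    m = (u + v) % S
    g = (u + v) / S
    order₂ : ∀ F S B → F * (S * B) ≡ B * (F * S)
    order₂ = solve-∀
    order₃ : ∀ F S B → F * (S * B) ≡ S * (F * B)
    order₃ = solve-∀
    regroup₂ : ∀ u v f S B → v + u * B + f * (S * B) ≡ v + (u + f * S) * B
    regroup₂ = solve-∀
    regroup₃ : ∀ m y f S B → m + y * S + f * (S * B) ≡ m + (y + f * B) * S
    regroup₃ = solve-∀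
    b≡ : b ≡ m + (g + x₂ * u + f * B) * S
    b≡ = trans (cong (ℕ._+ f * (S * B)) (mixed-radix x₂ S u v)) (regroup₃ m (g + x₂ * u) f S B)
    total : ∀ m g u f x₁ x₂ x₃ → m + (g + x₂ * u + f * (1 + x₂ * (1 + x₃))) * (1 + x₃) ≡
      (f + (m + g)) + (x₁ * 0 + (x₂ * (u + f * (1 + x₃)) + x₃ * (g + x₂ * u + f * (1 + x₂ * (1 + x₃)))))
    total = solve-∀

  hstarCoefficient-q : ∀ k → hstarCoefficient q k ≡ box x₁ (digitSumCount x₂ x₃) k
  hstarCoefficient-q k = begin
    Σ< (volume q) h
      ≡⟨ cong (λ s → Σ< s h) volume-q ⟩
    Σ< (F * (S * B)) h
      ≡⟨ Σ<-radix F (S * B) h ⟩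
    Σ< F (λ f → Σ< (S * B) (λ a → h (a + f * (S * B))))
      ≡⟨ Σ<-cong F (λ f f< → trans (Σ<-radix S B _)
           (Σ<-cong S λ u u< → Σ<-cong B λ v v< → cong δ
             (trans (cong (λ w → k ℤ.- int w) (weight-q f u v f< u< v<)) (minus-sum k f _)))) ⟩
    box x₁ (digitSumCount x₂ x₃) k ∎
    where
    open ≡-Reasoning
    h : ℕ → ℕ
    h b = δ (k ℤ.- int (weight q b))

theorem4p7 : (x₁ x₂ x₃ : ℕ) → 1 ≤ x₁ → 1 ≤ x₂ → 1 ≤ x₃ →
    (r₁ r₂ r₃ : ℕ) → RCase x₁ x₂ x₃ r₁ r₂ r₃ →
    HStarUnimodal _ (repVec r₁ r₂ r₃ x₁ x₂ x₃)
theorem4p7 x₁ x₂ x₃ _ _ _ _ _ _ case-i = hstar-unimodal (CaseI.q x₁ x₂ x₃)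
  (symmetricUnimodal-resp (λ k → sym (CaseI.hstarCoefficient-q x₁ x₂ x₃ k))
    (subst (λ d → SymmetricUnimodal (x₁ + (x₂ + d)) (box x₁ (box x₂ (box x₃ δ)))) (+-identityʳ x₃)
      (box-symmetricUnimodal x₁ (box-symmetricUnimodal x₂ (box-symmetricUnimodal x₃ δ-symmetricUnimodal)))))
-- The hypotheses exclude x₁ = 0 and x₂ = 0, so [x₁] and [x₂] are boxes.
theorem4p7 x₁@(suc y₁) x₂@(suc y₂) x₃ _ _ _ _ _ _ case-ii = hstar-unimodal (CaseII.q x₁ x₂ x₃)
  (symmetricUnimodal-resp (λ k → sym (CaseII.hstarCoefficient-q x₁ x₂ x₃ k))
    (subst (λ d → SymmetricUnimodal d (box x₃ (digitSumCount x₁ x₂))) (rotate x₁ x₂ x₃)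
      (box-symmetricUnimodal x₃ (digitSumCount-symmetricUnimodal y₁ y₂))))
  where
  rotate : ∀ x₁ x₂ x₃ → x₃ + (x₁ + x₂) ≡ x₁ + (x₂ + x₃)
  rotate = solve-∀
theorem4p7 x₁ x₂@(suc y₂) x₃@(suc y₃) _ _ _ _ _ _ case-iv = hstar-unimodal (CaseIV.q x₁ x₂ x₃)
  (symmetricUnimodal-resp (λ k → sym (CaseIV.hstarCoefficient-q x₁ x₂ x₃ k))
    (box-symmetricUnimodal x₁ (digitSumCount-symmetricUnimodal y₂ y₃)))
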